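{- Let $v\ge 3$ be an integer. There exist a perfect matching $I$ of the complete graph $K_v$ and a decomposition of the edge set of $K_v-I$ into $5$-star factors if and only if $v\equiv 12 \pmod{30}$. (Equivalently, for even $v\ge 4$ and any perfect matching $I$ of $K_v$, $K_v-I$ decomposes into $5$-star factors if and only if $v\equiv 12\pmod{30}$.)
   Context: A $5$-star is a copy of $K_{1,5}$. A $5$-star factor of a graph $H$ is a spanning subgraph of $H$ each of whose connected components is a $5$-star. A decomposition of $K_v-I$ into $5$-star factors is a collection of $5$-star factors of $K_v-I$ whose edge sets partition the edge set of $K_v-I$. -}

module Defs where

open import Data.Nat using (ℕ)
open import Data.Fin using (Fin)
open import Data.Vec using (Vec; toList)
open import Data.Vec.Membership.Propositional using () renaming (_∈_ to _∈ᵥ_)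
open import Data.List using (List; _∷_; concatMap; length; lookup)
open import Data.List.Relation.Unary.Any using (Any)
open import Data.List.Relation.Binary.Permutation.Propositional using (_↭_)
open import Data.Product using (Σ; _×_)
open import Data.Sum using (_⊎_)
open import Relation.Binary.PropositionalEquality using (_≡_; _≢_)

-- A perfect matching I of K_v, given as the fixed-point-free involution
-- sending each vertex to its partner: the edges of I are {x , m x}.
record PerfectMatching (v : ℕ) : Set where
  field
    partner     : Fin v → Fin v
    involutive  : ∀ x → partner (partner x) ≡ x
    noFixpoint  : ∀ x → partner x ≢ x
open PerfectMatching public

EdgeKmI : {v : ℕ} → PerfectMatching v → Fin v → Fin v → Set
EdgeKmI I x y = (x ≢ y) × (y ≢ partner I x)

record Star5 (v : ℕ) : Set where
  constructor star
  field
    center : Fin v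
    leaves : Vec (Fin v) 5
open Star5 public

starVertices : {v : ℕ} → Star5 v → List (Fin v)
starVertices s = center s ∷ toList (leaves s)

StarEdge : {v : ℕ} → Star5 v → Fin v → Fin v → Set
StarEdge s x y = (center s ≡ x × y ∈ᵥ leaves s) ⊎ (center s ≡ y × x ∈ᵥ leaves s)

FactorEdge : {v : ℕ} → List (Star5 v) → Fin v → Fin v → Set
FactorEdge F x y = Any (λ s → StarEdge s x y) F

-- A 5-star factor of K_v: a list of 5-stars whose vertex sets partition
-- the vertex set of K_v (every vertex occurs exactly once among all
-- centres and leaves).  The components of the spanning subgraph formed
-- by their edges are then exactly these 5-stars.
Is5StarFactor : {v : ℕ} → List (Star5 v) → Set
Is5StarFactor {v} F = concatMap starVertices F ↭ Data.List.allFin v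
  where import Data.List

record StarFactorDecomposition {v : ℕ} (I : PerfectMatching v) : Set where
  field
    factors      : List (List (Star5 v))
    areFactors   : ∀ i → Is5StarFactor (lookup factors i)
    subgraph     : ∀ i x y → FactorEdge (lookup factors i) x y → EdgeKmI I x y
    covered      : ∀ x y → EdgeKmI I x y →
                   Σ (Fin (length factors)) λ i →
                     FactorEdge (lookup factors i) x y ×
                     (∀ j → FactorEdge (lookup factors j) x y → j ≡ i)

{-# OPTIONS --safe #-}
module Submission where

open import Defs
open import Data.Nat as ℕ using (ℕ; zero; suc; _≤_; _%_; z≤n; s≤s; NonZero; >-nonZero)
import Data.Nat.Properties as ℕ
import Data.Nat.DivMod as ℕ
open import Data.Nat.Solver using () renaming (module +-*-Solver to ℕ-Solver)
import Data.Integer.Properties as ℤ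
open import Data.Integer.DivMod using (n%ℕd<d; a≡a%ℕn+[a/ℕn]*n)
open import Data.Integer.Solver using () renaming (module +-*-Solver to ℤ-Solver)
open import Data.Fin as Fin using (Fin; zero; suc; toℕ; fromℕ<)
import Data.Fin.Properties as Fin
open import Data.Vec as Vec using (Vec; []; _∷_; toList)
import Data.Vec.Properties as Vec
open import Data.Vec.Membership.Propositional.Properties using (∈-toList⁺; ∈-toList⁻)
open import Data.List using (List; []; _∷_; _++_; map; concatMap; length; lookup; filter; upTo; allFin; cartesianProduct)
import Data.List.Properties as List
open import Data.List.Membership.Propositional using (_∈_; find; lose)
open import Data.List.Membership.Propositional.Properties
import Data.List.Membership.DecPropositional as Membership
open import Data.List.Relation.Binary.Subset.Propositional using (_⊆_)
open import Data.List.Relation.Binary.Disjoint.Propositional using (Disjoint)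
open import Data.List.Relation.Binary.Permutation.Propositional using (_↭_; prep; ↭-refl; ↭-sym; ↭-trans; ↭⇒↭ₛ)
import Data.List.Relation.Binary.Permutation.Propositional.Properties as ↭
import Data.List.Relation.Binary.Permutation.Setoid.Properties as ↭ₛ
open import Data.List.Relation.Unary.All as All using (All; []; _∷_)
import Data.List.Relation.Unary.All.Properties as All
open import Data.List.Relation.Unary.Any as Any using (Any; here; there)
import Data.List.Relation.Unary.Any.Properties as Any
open import Data.List.Relation.Unary.AllPairs using ([]; _∷_)
open import Data.List.Relation.Unary.Unique.Propositional using (Unique)
import Data.List.Relation.Unary.Unique.Propositional.Properties as Unique
open import Data.Product using (Σ; ∃; ∃₂; _×_; _,_; proj₁; proj₂; swap; uncurry)
open import Data.Product.Properties using (,-injectiveˡ; ,-injectiveʳ; ≡-dec)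
open import Data.Sum as Sum using (_⊎_; inj₁; inj₂; [_,_]′)
open import Data.Empty using (⊥-elim)
open import Function using (_∘_; id)
open import Function.Bundles using (_⇔_; mk⇔)
open import Relation.Nullary using (Dec; yes; no; contradiction; ¬?; _×-dec_; _⊎-dec_; _→-dec_)
open import Relation.Nullary.Decidable using (map′; from-yes)
open import Relation.Unary using (Decidable)
open import Relation.Binary.Definitions using (tri<; tri≈; tri>)
open import Relation.Binary.PropositionalEquality

-- Counting edges gives 5 r + 6 = 18 m for r factors of m = v / 6 stars each, hence m ≡ 2 modulo 5.
-- Conversely, again by counting, it suffices to cover all vertices by every factor and all edges by
-- some factor.  For v = 6 m take the vertices to be ℤ/v, and match antipodes.  The factors are the
-- v / 2 translates by even numbers of one base factor, together with tilings: a star whose points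
-- are distinct modulo 6 is translated by 2 j + 6 ℤ, for j = 0, 1, 2.  So each orbit of edges under even
-- translations, that is, each parity of x and each d < v / 2 for the edge {x , x + d}, has to occur
-- in the base factor or in a star that is tiled.  In the base factor most stars have their centre
-- at − (5 A + a) and leaves at 25 A + b (or the mirror image of this) for A < k, so that d = 30 A + a + b
-- runs through residue classes modulo 30 as A varies.  The finitely many a, b and the irregular
-- stars were found by computer search, separately for v = 60 k + 42 and v = 60 k + 72, and for
-- v = 12 a direct construction remains.

module Counting where

  open import Data.Nat using (_+_; _*_; _/_)

  -- Counting with duplicate-free lists

  module _ {a} {A : Set a} where

    Unique-resp-↭ : {xs ys : List A} → xs ↭ ys → Unique xs → Unique ys
    Unique-resp-↭ p = ↭ₛ.Unique-resp-↭ (setoid A) (↭⇒↭ₛ p)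

    -- One occurrence of `x` is deleted from `ys`; the tail of `xs` still embeds in what is left,
    -- because it does not contain `x`.
    complement : {xs ys : List A} → Unique xs → xs ⊆ ys → ∃ λ zs → ys ↭ xs ++ zs
    complement {[]} _ _ = _ , ↭-refl
    complement {x ∷ xs} (x∉xs ∷ xs!) xs⊆ys with ∈-∃++ (xs⊆ys (here refl))
    ... | as , bs , refl =
      let zs , p = complement xs! xs⊆as++bs in zs , ↭-trans (↭.shift x as bs) (prep x p)
      where
      xs⊆as++bs : xs ⊆ as ++ bs
      xs⊆as++bs y∈xs with ↭.∈-resp-↭ (↭.shift x as bs) (xs⊆ys (there y∈xs))
      ... | here refl = contradiction refl (All.lookup x∉xs y∈xs)
      ... | there y∈  = y∈

    -- Pigeonhole: the complement of `xs` in `ys` has length zero. That `ys` is duplicate-free is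
    -- thus a consequence, and this turns a covering of the right size into a partition.
    ⊆∧length≡⇒↭ : {xs ys : List A} → Unique xs → xs ⊆ ys → length ys ≡ length xs → ys ↭ xs
    ⊆∧length≡⇒↭ {xs} {ys} xs! xs⊆ys eq with complement xs! xs⊆ys
    ... | [] , p = ↭-trans p (↭.++-identityʳ xs)
    ... | z ∷ zs , p = contradiction
      (ℕ.+-cancelˡ-≡ (length xs) _ 0 (trans (sym (List.length-++ xs)) (trans (sym (↭.↭-length p))
          (trans eq (sym (ℕ.+-identityʳ _))))))
      λ ()

    unique-length : {xs ys : List A} → Unique xs → Unique ys → xs ⊆ ys → ys ⊆ xs → length xs ≡ length ys
    unique-length {xs} {ys} xs! ys! xs⊆ys ys⊆xs = ℕ.≤-antisym (le xs! xs⊆ys) (le ys! ys⊆xs)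
      where
      le : {us vs : List A} → Unique us → us ⊆ vs → length us ≤ length vs
      le {us} us! us⊆vs =
        let zs , p = complement us! us⊆vs
        in subst (length us ≤_) (sym (trans (↭.↭-length p) (List.length-++ us))) (ℕ.m≤m+n _ _)

    Unique-++⁻ : ∀ xs {ys : List A} → Unique (xs ++ ys) → Unique ys × Disjoint xs ys
    Unique-++⁻ [] ys! = ys! , λ ()
    Unique-++⁻ (x ∷ xs) (x∉ ∷ u) with Unique-++⁻ xs u
    ... | ys! , xs#ys = ys! , λ where
      (here refl , v∈ys) → All.lookup x∉ (∈-++⁺ʳ xs v∈ys) refl
      (there v∈xs , v∈ys) → xs#ys (v∈xs , v∈ys)

  module _ {a b} {A : Set a} {B : Set b} (f : A → List B) where

    length-concatMap : ∀ {n} xs → All (λ x → length (f x) ≡ n) xs → length (concatMap f xs) ≡ length xs * n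
    length-concatMap [] [] = refl
    length-concatMap (x ∷ xs) (eq ∷ eqs) = trans (List.length-++ (f x)) (cong₂ _+_ eq (length-concatMap xs eqs))

    concatMap-index : ∀ {y} xs → y ∈ concatMap f xs → ∃ λ i → y ∈ f (lookup xs i)
    concatMap-index xs y∈ = Any.index any , Any.lookup-index any
      where any = ∈-concatMap⁻ f {xs = xs} y∈

    ∈-concatMap-lookup : ∀ {y} xs i → y ∈ f (lookup xs i) → y ∈ concatMap f xs
    ∈-concatMap-lookup xs i y∈ = ∈-concatMap⁺ f (Any.map (λ { refl → y∈ }) (∈-lookup {xs = xs} i))

    -- A common element of two blocks at different positions would occur twice in the concatenation.
    unique-index : ∀ {y} xs → Unique (concatMap f xs) → ∀ i j →
                   y ∈ f (lookup xs i) → y ∈ f (lookup xs j) → i ≡ j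
    unique-index (x ∷ xs) u zero zero p q = refl
    unique-index (x ∷ xs) u zero (suc j) p q =
      ⊥-elim (proj₂ (Unique-++⁻ (f x) u) (p , ∈-concatMap-lookup xs j q))
    unique-index (x ∷ xs) u (suc i) zero p q =
      ⊥-elim (proj₂ (Unique-++⁻ (f x) u) (q , ∈-concatMap-lookup xs i p))
    unique-index (x ∷ xs) u (suc i) (suc j) p q =
      cong suc (unique-index xs (proj₁ (Unique-++⁻ (f x) u)) i j p q)

    Unique-concatMap : ∀ xs → (∀ i → Unique (f (lookup xs i))) →
                       (∀ {y} i j → y ∈ f (lookup xs i) → y ∈ f (lookup xs j) → i ≡ j) →
                       Unique (concatMap f xs)
    Unique-concatMap [] _ _ = []
    Unique-concatMap (x ∷ xs) u inj = Unique.++⁺ (u zero)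
      (Unique-concatMap xs (u ∘ suc) (λ i j p q → Fin.suc-injective (inj (suc i) (suc j) p q)))
      λ (p , q) → let i , q′ = concatMap-index xs q in Fin.0≢1+n (inj zero (suc i) p q′)

  length-allFin : ∀ n → length (allFin n) ≡ n
  length-allFin n = List.length-tabulate {n = n} id

  length-cartesianProduct : ∀ {a b} {A : Set a} {B : Set b} (xs : List A) (ys : List B) →
                            length (cartesianProduct xs ys) ≡ length xs * length ys
  length-cartesianProduct []       ys = refl
  length-cartesianProduct (x ∷ xs) ys = trans (List.length-++ (map (x ,_) ys))
    (cong₂ _+_ (List.length-map (x ,_) ys) (length-cartesianProduct xs ys))

  -- Edges of stars and factors, each listed in both directions

  module _ {v : ℕ} where

    private
      V = Fin v

    leafList : Star5 v → List V
    leafList s = toList (leaves s)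

    arcs : Star5 v → List (V × V)
    arcs s = map (center s ,_) (leafList s)

    factorArcs : List (Star5 v) → List (V × V)
    factorArcs = concatMap arcs

    edges : List (Star5 v) → List (V × V)
    edges F = factorArcs F ++ map swap (factorArcs F)

    allEdges : List (List (Star5 v)) → List (V × V)
    allEdges = concatMap edges

    ∈-arcs⁻ : ∀ {x y} s → (x , y) ∈ arcs s → center s ≡ x × y ∈ leafList s
    ∈-arcs⁻ s p with ∈-map⁻ (center s ,_) p
    ... | _ , l∈ , refl = refl , l∈

    FactorEdge⇒∈ : ∀ F {x y} → FactorEdge F x y → (x , y) ∈ edges F
    FactorEdge⇒∈ F {x} {y} e = [ ∈-++⁺ˡ ∘ ∈-concatMap⁺ arcs , ∈-++⁺ʳ (factorArcs F) ∘ ∈-map⁺ swap ∘ ∈-concatMap⁺ arcs ]′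
        (Any.Any-⊎⁻ (Any.map (Sum.map out out) e))
      where
      out : ∀ {s x y} → center s ≡ x × _ → (x , y) ∈ arcs s
      out (refl , y∈) = ∈-map⁺ _ (∈-toList⁺ y∈)

    ∈⇒FactorEdge : ∀ F {x y} → (x , y) ∈ edges F → FactorEdge F x y
    ∈⇒FactorEdge F p with ∈-++⁻ (factorArcs F) p
    ... | inj₁ q = Any.map (λ {s} r → inj₁ (proj₁ (∈-arcs⁻ s r) , ∈-toList⁻ (proj₂ (∈-arcs⁻ s r))))
                     (∈-concatMap⁻ arcs {xs = F} q)
    ... | inj₂ q with ∈-map⁻ swap q
    ... | _ , r , refl = Any.map (λ {s} r → inj₂ (proj₁ (∈-arcs⁻ s r) , ∈-toList⁻ (proj₂ (∈-arcs⁻ s r))))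
                           (∈-concatMap⁻ arcs {xs = F} r)

    length-vertices : (F : List (Star5 v)) → length (concatMap starVertices F) ≡ length F * 6
    length-vertices F = length-concatMap starVertices F (All.universal (λ s → cong suc (Vec.length-toList (leaves s))) F)

    length-edges : ∀ F → length (edges F) ≡ length F * 10
    length-edges F = begin
      length (edges F) ≡⟨ List.length-++ (factorArcs F) ⟩
      length (factorArcs F) + length (map swap (factorArcs F))
        ≡⟨ cong (length (factorArcs F) +_) (List.length-map swap (factorArcs F)) ⟩
      length (factorArcs F) + length (factorArcs F)
        ≡⟨ cong (λ n → n + n) (length-concatMap arcs F (All.universal (λ s → trans (List.length-map _ (leafList s))
            (Vec.length-toList (leaves s))) F)) ⟩
      length F * 5 + length F * 5 ≡⟨ ℕ.*-distribˡ-+ (length F) 5 5 ⟨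
      length F * 10 ∎
      where open ≡-Reasoning

    centres++leaves : ∀ F → concatMap starVertices F ↭ map center F ++ concatMap leafList F
    centres++leaves [] = ↭-refl
    centres++leaves (s ∷ F) = prep (center s)
      (↭-trans (↭.++⁺ˡ (leafList s) (centres++leaves F)) (↭.shifts (leafList s) (map center F)))

    ends : ∀ F {x y} → (x , y) ∈ factorArcs F → x ∈ map center F × y ∈ concatMap leafList F
    ends F p = Any.map⁺ (Any.map (λ {s} r → sym (proj₁ (∈-arcs⁻ s r))) q) ,
               ∈-concatMap⁺ leafList (Any.map (λ {s} r → proj₂ (∈-arcs⁻ s r)) q)
      where q = ∈-concatMap⁻ arcs {xs = F} p

    heads : ∀ F → map proj₂ (factorArcs F) ≡ concatMap leafList F
    heads F = trans (List.map-concatMap proj₂ arcs F)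
      (List.concatMap-cong (λ s → trans (sym (List.map-∘ (leafList s))) (List.map-id (leafList s))) F)

    -- A leaf determines its arc, because leaves do not repeat within a factor. An arc never equals
    -- a reversed arc, because no vertex is both a centre and a leaf.
    edges-unique : ∀ F → Is5StarFactor F → Unique (edges F)
    edges-unique F isF = Unique.++⁺ arcs! (Unique.map⁺ (cong swap) arcs!) λ (p , q) →
        let _ , r , eq = ∈-map⁻ swap q
        in proj₂ split (subst (_∈ map center F) (sym (,-injectiveʳ eq)) (proj₁ (ends F r)) , proj₂ (ends F p))
      where
      split = Unique-++⁻ (map center F)
                (Unique-resp-↭ (↭-trans (↭-sym isF) (centres++leaves F)) (Unique.allFin⁺ v))
      arcs! : Unique (factorArcs F)
      arcs! = Unique.map⁻ (subst Unique (sym (heads F)) (proj₁ split))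

    module _ (I : PerfectMatching v) where

      EdgeKmI? : Decidable (uncurry (EdgeKmI I))
      EdgeKmI? (x , y) = ¬? (x Fin.≟ y) ×-dec ¬? (y Fin.≟ partner I x)

      edgesKmI : List (V × V)
      edgesKmI = filter EdgeKmI? (cartesianProduct (allFin v) (allFin v))

      edgesKmI-unique : Unique edgesKmI
      edgesKmI-unique = Unique.filter⁺ EdgeKmI? (Unique.cartesianProduct⁺ (Unique.allFin⁺ v) (Unique.allFin⁺ v))

      ∈-edgesKmI⁺ : ∀ {x y} → EdgeKmI I x y → (x , y) ∈ edgesKmI
      ∈-edgesKmI⁺ e = ∈-filter⁺ EdgeKmI? (∈-cartesianProduct⁺ (∈-allFin _) (∈-allFin _)) e

      ∈-edgesKmI⁻ : ∀ {x y} → (x , y) ∈ edgesKmI → EdgeKmI I x y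
      ∈-edgesKmI⁻ p = proj₂ (∈-filter⁻ EdgeKmI? {xs = cartesianProduct (allFin v) (allFin v)} p)

      private
        graph : (V → V) → List (V × V)
        graph f = map (λ x → x , f x) (allFin v)

        graph-unique : ∀ f → Unique (graph f)
        graph-unique f = Unique.map⁺ ,-injectiveˡ (Unique.allFin⁺ v)

        ∈-graph : ∀ {f p} → p ∈ graph f → proj₂ p ≡ f (proj₁ p)
        ∈-graph p∈ with ∈-map⁻ _ p∈
        ... | _ , _ , refl = refl

      -- The v² ordered pairs split into the diagonal, the graph of `partner` and the edges; the
      -- first two are disjoint since `partner` has no fixed point.
      length-edgesKmI : v + (v + length edgesKmI) ≡ v * v
      length-edgesKmI = begin
        v + (v + length edgesKmI)
          ≡⟨ cong₂ (λ m n → m + (n + length edgesKmI)) (len id) (len (partner I)) ⟨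
        length (graph id) + (length (graph (partner I)) + length edgesKmI)
          ≡⟨ cong (length (graph id) +_) (List.length-++ (graph (partner I))) ⟨
        length (graph id) + length (graph (partner I) ++ edgesKmI)
          ≡⟨ List.length-++ (graph id) ⟨
        length (graph id ++ graph (partner I) ++ edgesKmI)
          ≡⟨ unique-length all! (Unique.cartesianProduct⁺ (Unique.allFin⁺ v) (Unique.allFin⁺ v))
               (λ _ → ∈-cartesianProduct⁺ (∈-allFin _) (∈-allFin _)) (λ {p} _ → all∈ p) ⟩
        length (cartesianProduct (allFin v) (allFin v))
          ≡⟨ length-cartesianProduct (allFin v) (allFin v) ⟩
        length (allFin v) * length (allFin v)
          ≡⟨ cong (λ n → n * n) (length-allFin v) ⟩
        v * v ∎
        where
        open ≡-Reasoning
        len : ∀ f → length (graph f) ≡ v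
        len f = trans (List.length-map _ (allFin v)) (length-allFin v)
        all! : Unique (graph id ++ graph (partner I) ++ edgesKmI)
        all! = Unique.++⁺ (graph-unique id)
          (Unique.++⁺ (graph-unique (partner I)) edgesKmI-unique
            λ (p , q) → proj₂ (∈-edgesKmI⁻ q) (∈-graph p))
          λ (p , q) → [ (λ r → noFixpoint I _ (trans (sym (∈-graph r)) (∈-graph p)))
                      , (λ r → proj₁ (∈-edgesKmI⁻ r) (sym (∈-graph p))) ]′ (∈-++⁻ (graph (partner I)) q)
        all∈ : ∀ p → p ∈ graph id ++ graph (partner I) ++ edgesKmI
        all∈ (x , y) with x Fin.≟ y | y Fin.≟ partner I x
        ... | yes refl | _ = ∈-++⁺ˡ (∈-map⁺ _ (∈-allFin x))
        ... | no _ | yes refl = ∈-++⁺ʳ (graph id) (∈-++⁺ˡ (∈-map⁺ _ (∈-allFin x)))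
        ... | no x≢y | no y≢x′ = ∈-++⁺ʳ (graph id) (∈-++⁺ʳ (graph (partner I)) (∈-edgesKmI⁺ (x≢y , y≢x′)))

  -- Covering everything with the right number of stars is covering exactly once

  module _ {v : ℕ} (I : PerfectMatching v) (m : ℕ) (v≡m*6 : v ≡ m * 6) where

    factor-from-cover : ∀ F → length F ≡ m → (∀ x → x ∈ concatMap starVertices F) → Is5StarFactor F
    factor-from-cover F len cov = ⊆∧length≡⇒↭ (Unique.allFin⁺ v) (λ {x} _ → cov x)
      (trans (length-vertices F) (trans (cong (_* 6) len) (trans (sym v≡m*6) (sym (length-allFin v)))))

    -- The last hypothesis says that the stars supply exactly as many ordered pairs as K_v - I has,
    -- so `allEdges 𝓕` is a permutation of `edgesKmI I`. Hence no star uses an edge of I, and no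
    -- edge lies in two factors.
    decomposition-from-cover : ∀ 𝓕 → All (λ F → length F ≡ m) 𝓕 →
      All (λ F → ∀ x → x ∈ concatMap starVertices F) 𝓕 →
      (∀ x y → EdgeKmI I x y → (x , y) ∈ allEdges 𝓕) →
      v + (v + length 𝓕 * (m * 10)) ≡ v * v →
      StarFactorDecomposition I
    decomposition-from-cover 𝓕 len cov edge∈ count = record
      { factors = 𝓕
      ; areFactors = λ i → factor-from-cover (lookup 𝓕 i) (All.lookup len (∈-lookup i)) (All.lookup cov (∈-lookup i))
      ; subgraph = λ i x y e → ∈-edgesKmI⁻ I
          (↭.∈-resp-↭ perm (∈-concatMap-lookup edges 𝓕 i (FactorEdge⇒∈ (lookup 𝓕 i) e)))
      ; covered = λ x y e →
          let i , p = concatMap-index edges 𝓕 (edge∈ x y e)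
          in i , ∈⇒FactorEdge (lookup 𝓕 i) p ,
             λ j q → unique-index edges 𝓕 (Unique-resp-↭ (↭-sym perm) (edgesKmI-unique I)) j i
                       (FactorEdge⇒∈ (lookup 𝓕 j) q) p
      }
      where
      length-all : length (allEdges 𝓕) ≡ length 𝓕 * (m * 10)
      length-all = length-concatMap edges 𝓕 (All.map (λ {F} eq → trans (length-edges F) (cong (_* 10) eq)) len)
      perm : allEdges 𝓕 ↭ edgesKmI I
      perm = ⊆∧length≡⇒↭ (edgesKmI-unique I) (λ p → edge∈ _ _ (∈-edgesKmI⁻ I p))
        (ℕ.+-cancelˡ-≡ v _ _ (ℕ.+-cancelˡ-≡ v _ _ (trans (cong (λ n → v + (v + n)) length-all)
            (trans count (sym (length-edgesKmI I))))))

  -- Necessity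

  module _ {v : ℕ} {I : PerfectMatching v} (D : StarFactorDecomposition I) where
    open StarFactorDecomposition D

    length-factor : ∀ i → length (lookup factors i) * 6 ≡ v
    length-factor i = trans (sym (length-vertices (lookup factors i))) (trans (↭.↭-length (areFactors i)) (length-allFin v))

    -- By uniqueness in `covered` the edge lists of different factors are disjoint, so their
    -- concatenation lists each ordered edge of K_v - I once.
    length-allEdges : v + (v + length (allEdges factors)) ≡ v * v
    length-allEdges = trans (cong (λ n → v + (v + n)) (unique-length
        (Unique-concatMap edges factors (λ i → edges-unique (lookup factors i) (areFactors i)) index-unique)
        (edgesKmI-unique I) ⊆₁ ⊆₂)) (length-edgesKmI I)
      where
      ⊆₁ : allEdges factors ⊆ edgesKmI I
      ⊆₁ p = let i , q = concatMap-index edges factors p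
             in ∈-edgesKmI⁺ I (subgraph i _ _ (∈⇒FactorEdge (lookup factors i) q))
      ⊆₂ : edgesKmI I ⊆ allEdges factors
      ⊆₂ p = let i , q , _ = covered _ _ (∈-edgesKmI⁻ I p)
             in ∈-concatMap-lookup edges factors i (FactorEdge⇒∈ (lookup factors i) q)
      index-unique : ∀ {p} i j → p ∈ edges (lookup factors i) → p ∈ edges (lookup factors j) → i ≡ j
      index-unique i j p q =
        let e = ∈⇒FactorEdge (lookup factors i) p
            _ , _ , u = covered _ _ (subgraph i _ _ e)
        in trans (u i e) (sym (u j (∈⇒FactorEdge (lookup factors j) q)))

  module _ where
    open ≡-Reasoning
    open ℕ-Solver

    -- Cancelling m from 12 m + 10 r m = 36 m² leaves 12 + 10 r = 36 m, and 36 ≡ 1 modulo 5.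
    mod5 : ∀ m .{{_ : NonZero m}} r → m * 6 + (m * 6 + r * (m * 10)) ≡ m * 6 * (m * 6) → m % 5 ≡ 2
    mod5 m r eq = begin
      m % 5                          ≡⟨ ℕ.[m+kn]%n≡m%n m (m * 7) 5 ⟨
      (m + m * 7 * 5) % 5            ≡⟨ cong (_% 5) (solve 1 (λ m → m :+ m :* con 7 :* con 5 := m :* con 36) refl m) ⟩
      (m * 36) % 5                   ≡⟨ cong (_% 5) (ℕ.*-cancelˡ-≡ _ _ m eq′) ⟨
      (2 + (r * 2 + 2) * 5) % 5      ≡⟨ ℕ.[m+kn]%n≡m%n 2 (r * 2 + 2) 5 ⟩
      2                              ∎
      where
      eq′ : m * (2 + (r * 2 + 2) * 5) ≡ m * (m * 36)
      eq′ = begin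
        m * (2 + (r * 2 + 2) * 5)
          ≡⟨ solve 2 (λ m r → m :* (con 2 :+ (r :* con 2 :+ con 2) :* con 5) := m :* con 6 :+
              (m :* con 6 :+ r :* (m :* con 10))) refl m r ⟩
        m * 6 + (m * 6 + r * (m * 10))       ≡⟨ eq ⟩
        m * 6 * (m * 6)                      ≡⟨ solve 1 (λ m → m :* con 6 :* (m :* con 6) := m :* (m :* con 36)) refl m ⟩
        m * (m * 36)                         ∎

    mod30 : ∀ m → m % 5 ≡ 2 → (m * 6) % 30 ≡ 12
    mod30 m eq = begin
      (m * 6) % 30                     ≡⟨ cong (λ n → (n * 6) % 30) (trans (ℕ.m≡m%n+[m/n]*n m 5) (cong (_+ q * 5) eq)) ⟩
      ((2 + q * 5) * 6) % 30           ≡⟨ cong (_% 30) (solve 1 (λ q → (con 2 :+ q :* con 5) :* con 6 := con 12 :+ q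
          :* con 30) refl q) ⟩
      (12 + q * 30) % 30               ≡⟨ ℕ.[m+kn]%n≡m%n 12 q 30 ⟩
      12                               ∎
      where
      q = m / 5

  necessity : ∀ {v} → 3 ≤ v → {I : PerfectMatching v} → StarFactorDecomposition I → v % 30 ≡ 12
  necessity {v} 3≤v {I} D with StarFactorDecomposition.factors D | length-factor D | length-allEdges D
  ... | [] | _ | count = ⊥-elim (no-factor v 3≤v count)
    where
    no-factor : ∀ v → 3 ≤ v → v + (v + 0) ≢ v * v
    -- Without factors the count reads 2 v = v², so v = 2.
    no-factor v@(suc _) 3≤v eq with ℕ.*-cancelʳ-≡ 2 v v (trans eq refl)
    ... | refl = contradiction 3≤v λ { (s≤s (s≤s ())) }
  ... | F ∷ 𝓕 | len | count = subst (λ v → v % 30 ≡ 12) (len zero) (mod30 m (mod5 m {{m≢0}} (length (F ∷ 𝓕)) count′))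
    where
    m = length F
    m≢0 : NonZero m
    m≢0 = ℕ.m*n≢0⇒m≢0 m {{>-nonZero (ℕ.≤-trans (s≤s z≤n) (subst (3 ≤_) (sym (len zero)) 3≤v))}}
    same : ∀ i → length (lookup (F ∷ 𝓕) i) ≡ m
    same i = ℕ.*-cancelʳ-≡ _ m 6 (trans (len i) (sym (len zero)))
    all-same : ∀ 𝓖 → (∀ i → length (lookup 𝓖 i) ≡ m) → All (λ F → length F ≡ m) 𝓖
    all-same [] _ = []
    all-same (G ∷ 𝓖) h = h zero ∷ all-same 𝓖 (h ∘ suc)
    total : length (allEdges (F ∷ 𝓕)) ≡ length (F ∷ 𝓕) * (m * 10)
    total = length-concatMap edges (F ∷ 𝓕) (All.map (λ {G} eq → trans (length-edges G) (cong (_* 10) eq))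
        (all-same (F ∷ 𝓕) same))
    count′ : m * 6 + (m * 6 + length (F ∷ 𝓕) * (m * 10)) ≡ m * 6 * (m * 6)
    count′ = subst (λ v → v + (v + length (F ∷ 𝓕) * (m * 10)) ≡ v * v) (sym (len zero))
        (trans (cong (λ n → v + (v + n)) (sym total)) count)

open Counting

-- Integers modulo v

open import Data.Integer as ℤ using (ℤ; +_; -[1+_]; _+_; _*_; -_; _-_; _%ℕ_; _/ℕ_)

module _ (v : ℕ) .{{_ : NonZero v}} where

  private
    -- A positive `q` would force r ≥ v, a negative one s ≥ v.
    residue-unique : ∀ {r s} q → r ℕ.< v → s ℕ.< v → + r ≡ + s + q * + v → r ≡ s
    residue-unique {r} {s} (+ zero) _ _ eq = ℤ.+-injective (trans eq (ℤ.+-identityʳ (+ s)))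
    residue-unique {r} {s} (+ suc n) r<v _ eq =
      contradiction r<v (ℕ.≤⇒≯ (subst (v ℕ.≤_) (sym r≡) (ℕ.≤-trans (ℕ.m≤m+n v (n ℕ.* v)) (ℕ.m≤n+m _ s))))
      where
      r≡ : r ≡ s ℕ.+ suc n ℕ.* v
      r≡ = ℤ.+-injective (trans eq (cong (_+_ (+ s)) (sym (ℤ.pos-* (suc n) v))))
    residue-unique {r} {s} -[1+ n ] _ s<v eq =
      contradiction s<v (ℕ.≤⇒≯ (subst (v ℕ.≤_) (sym s≡) (ℕ.≤-trans (ℕ.m≤m+n v (n ℕ.* v)) (ℕ.m≤n+m _ r))))
      where
      open ℤ-Solver
      s≡ : s ≡ r ℕ.+ suc n ℕ.* v
      s≡ = ℤ.+-injective (begin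
        + s                                             ≡⟨ solve 3 (λ s n v → s := s :+ (:- n) :* v :+ n :* v) refl
            (+ s) (+ suc n) (+ v) ⟩
        + s + -[1+ n ] * + v + + suc n * + v            ≡⟨ cong (_+ + suc n * + v) eq ⟨
        + r + + suc n * + v                             ≡⟨ cong (_+_ (+ r)) (sym (ℤ.pos-* (suc n) v)) ⟩
        + (r ℕ.+ suc n ℕ.* v)                           ∎)
        where open ≡-Reasoning

  pt : ℤ → Fin v
  pt z = fromℕ< (n%ℕd<d z v)

  pt-split : ∀ z → z ≡ + toℕ (pt z) + (z /ℕ v) * + v
  pt-split z = trans (a≡a%ℕn+[a/ℕn]*n z v) (cong (λ r → + r + (z /ℕ v) * + v) (sym (Fin.toℕ-fromℕ< (n%ℕd<d z v))))

  pt-period : ∀ {z w} q → z ≡ w + q * + v → pt z ≡ pt w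
  pt-period {z} {w} q eq = Fin.toℕ-injective (residue-unique (w /ℕ v + q - z /ℕ v) (Fin.toℕ<n (pt z)) (Fin.toℕ<n (pt w)) (begin
    + toℕ (pt z)                                      ≡⟨ solve 3 (λ r a v → r := r :+ a :* v :- a :* v) refl
        (+ toℕ (pt z)) (z /ℕ v) (+ v) ⟩
    + toℕ (pt z) + (z /ℕ v) * + v - (z /ℕ v) * + v    ≡⟨ cong (_- (z /ℕ v) * + v)
        (trans (sym (pt-split z)) (trans eq (cong (_+ q * + v) (pt-split w)))) ⟩
    + toℕ (pt w) + (w /ℕ v) * + v + q * + v - (z /ℕ v) * + v
      ≡⟨ solve 5 (λ s b q a v → s :+ b :* v :+ q :* v :- a :* v := s :+ (b :+ q :- a) :* v) refl (+ toℕ (pt w))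
          (w /ℕ v) q (z /ℕ v) (+ v) ⟩
    + toℕ (pt w) + (w /ℕ v + q - z /ℕ v) * + v        ∎))
    where
    open ≡-Reasoning
    open ℤ-Solver

  pt-toℕ : ∀ x → pt (+ toℕ x) ≡ x
  pt-toℕ x = Fin.toℕ-injective (trans (Fin.toℕ-fromℕ< _) (ℕ.m<n⇒m%n≡m (Fin.toℕ<n x)))

  pt-≡⇒ : ∀ {z w} → pt z ≡ pt w → ∃ λ q → z ≡ w + q * + v
  pt-≡⇒ {z} {w} eq = z /ℕ v - w /ℕ v , (begin
    z                                 ≡⟨ pt-split z ⟩
    + toℕ (pt z) + (z /ℕ v) * + v     ≡⟨ cong (λ x → + toℕ x + (z /ℕ v) * + v) eq ⟩
    + toℕ (pt w) + (z /ℕ v) * + v     ≡⟨ solve 4 (λ s a b v → s :+ a :* v := s :+ b :* v :+ (a :- b) :* v) refl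
        (+ toℕ (pt w)) (z /ℕ v) (w /ℕ v) (+ v) ⟩
    + toℕ (pt w) + (w /ℕ v) * + v + (z /ℕ v - w /ℕ v) * + v ≡⟨ cong (_+ (z /ℕ v - w /ℕ v) * + v) (pt-split w) ⟨
    w + (z /ℕ v - w /ℕ v) * + v       ∎)
    where
    open ≡-Reasoning
    open ℤ-Solver

-- The antipodal matching

antipodal : ∀ h .{{_ : NonZero h}} .{{_ : NonZero (h ℕ.* 2)}} → PerfectMatching (h ℕ.* 2)
antipodal h = record
  -- Adding h twice adds v once; the quotient q dropped when x + h is reduced has to be returned,
  -- hence the multiple 1 - q of v.
  { partner = λ x → pt v (+ toℕ x + + h)
  ; involutive = λ x → trans (pt-period v {_} {+ toℕ x} (+ 1 - (+ toℕ x + + h) /ℕ v) (begin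
      + toℕ (pt v (+ toℕ x + + h)) + + h
        ≡⟨ solve 4 (λ r q v h → r :+ h := r :+ q :* v :- q :* v :+ h) refl (+ toℕ (pt v (+ toℕ x + + h)))
            ((+ toℕ x + + h) /ℕ v) (+ v) (+ h) ⟩
      + toℕ (pt v (+ toℕ x + + h)) + ((+ toℕ x + + h) /ℕ v) * + v - ((+ toℕ x + + h) /ℕ v) * + v + + h
        ≡⟨ cong (λ z → z - ((+ toℕ x + + h) /ℕ v) * + v + + h) (pt-split v (+ toℕ x + + h)) ⟨
      + toℕ x + + h - ((+ toℕ x + + h) /ℕ v) * + v + + h
        ≡⟨ cong (λ w → + toℕ x + + h - ((+ toℕ x + + h) /ℕ v) * w + + h) v≡ ⟩
      + toℕ x + + h - ((+ toℕ x + + h) /ℕ v) * (+ h * + 2) + + h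
        ≡⟨ solve 3 (λ x h q → x :+ h :- q :* (h :* con (+ 2)) :+ h := x :+ (con (+ 1) :- q) :* (h :* con (+ 2)))
            refl (+ toℕ x) (+ h) ((+ toℕ x + + h) /ℕ v) ⟩
      + toℕ x + (+ 1 - (+ toℕ x + + h) /ℕ v) * (+ h * + 2)
        ≡⟨ cong (λ w → + toℕ x + (+ 1 - (+ toℕ x + + h) /ℕ v) * w) v≡ ⟨
      + toℕ x + (+ 1 - (+ toℕ x + + h) /ℕ v) * + v ∎)) (pt-toℕ v x)
  -- A fixed point makes h a multiple of v = 2 h; but h is its own remainder modulo v, so h would be
  -- 0.
  ; noFixpoint = λ x eq →
      let q , eq′ = pt-≡⇒ v {+ toℕ x + + h} {+ toℕ x} (trans eq (sym (pt-toℕ v x)))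
      in ℕ.≢-nonZero⁻¹ h (trans (sym (ℕ.m<n⇒m%n≡m (ℕ.m<m*n h 2 (s≤s (s≤s z≤n)))))
           (trans (sym (Fin.toℕ-fromℕ< (n%ℕd<d (+ h) v))) (trans (cong toℕ (pt-period v {+ h} {+ 0} q (begin
             + h ≡⟨ solve 2 (λ x h → h := x :+ h :- x) refl (+ toℕ x) (+ h) ⟩
             + toℕ x + + h - + toℕ x ≡⟨ cong (_- + toℕ x) eq′ ⟩
             + toℕ x + q * + v - + toℕ x ≡⟨ solve 2 (λ x w → x :+ w :- x := con (+ 0) :+ w) refl (+ toℕ x) (q * + v) ⟩
             + 0 + q * + v ∎)))
           (trans (Fin.toℕ-fromℕ< (n%ℕd<d (+ 0) v)) (ℕ.m<n⇒m%n≡m (ℕ.>-nonZero⁻¹ v))))))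
  }
  where
  open ≡-Reasoning
  open ℤ-Solver
  v = h ℕ.* 2
  v≡ : + v ≡ + h * + 2
  v≡ = ℤ.pos-* h 2

-- Positions that are affine in the parameters k and A

record Affine : Set where
  constructor affine
  field
    const kCoeff ACoeff : ℤ

infixl 6 _⊕_ _⊖_
infixl 8 _⟨_⟩

_⊕_ _⊖_ : Affine → Affine → Affine
affine u x y ⊕ affine u′ x′ y′ = affine (u + u′) (x + x′) (y + y′)
affine u x y ⊖ affine u′ x′ y′ = affine (u - u′) (x - x′) (y - y′)

scale : ℤ → Affine → Affine
scale c (affine u x y) = affine (c * u) (c * x) (c * y)

-- f ⟨ g ⟩ substitutes g for A
_⟨_⟩ : Affine → Affine → Affine
affine u x y ⟨ affine u′ x′ y′ ⟩ = affine (u + y * u′) (x + y * x′) (y * y′)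

𝟎 𝐤 𝐀+1 : Affine
𝟎 = affine (+ 0) (+ 0) (+ 0)
𝐤 = affine (+ 0) (+ 1) (+ 0)
𝐀+1 = affine (+ 1) (+ 0) (+ 1)

infix 4 _≟_
-- Equal coefficients give equal values for all k and A, so one finite comparison certifies an
-- identity for infinitely many v.
_≟_ : (f g : Affine) → Dec (f ≡ g)
affine u x y ≟ affine u′ x′ y′ =
  map′ (λ { (refl , refl , refl) → refl }) (λ { refl → refl , refl , refl })
    (u ℤ.≟ u′ ×-dec x ℤ.≟ x′ ×-dec y ℤ.≟ y′)

-- Divisibility of all three coefficients, expressed through their floor quotients: it is decided by
-- computation and implies divisibility of every value.
_∣ᶠ_ : (n : ℕ) .{{_ : NonZero n}} → Affine → Set
n ∣ᶠ f@(affine u x y) = f ≡ scale (+ n) (affine (u /ℕ n) (x /ℕ n) (y /ℕ n))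

_∣ᶠ?_ : (n : ℕ) .{{_ : NonZero n}} (f : Affine) → Dec (n ∣ᶠ f)
n ∣ᶠ? f = f ≟ _

module Evaluation (k : ℤ) where
  open ℤ-Solver

  eval : ℤ → Affine → ℤ
  eval A (affine u x y) = u + x * k + y * A

  eval-⊖ : ∀ A f g → eval A (f ⊖ g) ≡ eval A f - eval A g
  eval-⊖ A (affine u x y) (affine u′ x′ y′) =
    solve 8 (λ u x y u′ x′ y′ k A → (u :- u′) :+ (x :- x′) :* k :+ (y :- y′) :* A := (u :+ x :* k :+ y :* A) :-
        (u′ :+ x′ :* k :+ y′ :* A))
      refl u x y u′ x′ y′ k A

  eval-scale : ∀ A c f → eval A (scale c f) ≡ c * eval A f
  eval-scale A c (affine u x y) =
    solve 6 (λ u x y k A c → c :* u :+ c :* x :* k :+ c :* y :* A := c :* (u :+ x :* k :+ y :* A)) refl u x y k A c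

  eval-⟨⟩ : ∀ A f g → eval A (f ⟨ g ⟩) ≡ eval (eval A g) f
  eval-⟨⟩ A (affine u x y) (affine u′ x′ y′) =
    solve 8 (λ u x y u′ x′ y′ k A → (u :+ y :* u′) :+ (x :+ y :* x′) :* k :+ y :* y′ :* A := u :+ x :* k :+ y :*
        (u′ :+ x′ :* k :+ y′ :* A))
      refl u x y u′ x′ y′ k A

  eval-𝟎 : ∀ A → eval A 𝟎 ≡ + 0
  eval-𝟎 A = solve 2 (λ k A → con (+ 0) :+ con (+ 0) :* k :+ con (+ 0) :* A := con (+ 0)) refl k A

  eval-𝐤 : ∀ A → eval A 𝐤 ≡ k
  eval-𝐤 A = solve 2 (λ k A → con (+ 0) :+ con (+ 1) :* k :+ con (+ 0) :* A := k) refl k A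

  eval-𝐀+1 : ∀ A → eval A 𝐀+1 ≡ + 1 + A
  eval-𝐀+1 A = solve 2 (λ k A → con (+ 1) :+ con (+ 0) :* k :+ con (+ 1) :* A := con (+ 1) :+ A) refl k A

  eval-∣ᶠ : ∀ n .{{_ : NonZero n}} A f → n ∣ᶠ f → ∃ λ h → eval A f ≡ + n * h
  eval-∣ᶠ n A f@(affine u x y) eq = eval A (affine (u /ℕ n) (x /ℕ n) (y /ℕ n)) , trans (cong (eval A) eq)
      (eval-scale A (+ n) (affine (u /ℕ n) (x /ℕ n) (y /ℕ n)))

-- Families of stars

record Shape (X : Set) : Set where
  constructor shape
  field
    hub : X
    rim : Vec X 5
open Shape

mapShape : ∀ {X Y : Set} → (X → Y) → Shape X → Shape Y
mapShape f (shape c ls) = shape (f c) (Vec.map f ls)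

points : ∀ {X : Set} → Shape X → List X
points (shape c ls) = c ∷ toList ls

points-map : ∀ {X Y : Set} (f : X → Y) s → points (mapShape f s) ≡ map f (points s)
points-map f (shape c ls) = cong (f c ∷_) (Vec.toList-map f ls)

-- The running members range over 0 ≤ A < k; in the initial ones A = 0, and in the final ones A = k.
record Family : Set where
  field
    running initial final : List (Shape Affine)
open Family

module Members (k : ℕ) where
  open Evaluation (+ k) public

  at : ℤ → Shape Affine → Shape ℤ
  at A = mapShape (eval A)

  copies : Shape Affine → List (Shape ℤ)
  copies s = map (λ A → at (+ A) s) (upTo k)

  members : Family → List (Shape ℤ)
  members P = concatMap copies (running P)
           ++ map (at (+ 0)) (initial P) ++ map (at (+ k)) (final P)

  length-members : ∀ P → length (members P) ≡ length (running P) ℕ.* k ℕ.+ (length (initial P) ℕ.+ length (final P))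
  length-members P = trans (List.length-++ (concatMap copies (running P))) (cong₂ ℕ._+_
    (length-concatMap copies (running P) (All.universal (λ s → trans (List.length-map (λ A → at (+ A) s) (upTo k))
        (List.length-upTo k)) (running P)))
    (trans (List.length-++ (map (at (+ 0)) (initial P)))
      (cong₂ ℕ._+_ (List.length-map (at (+ 0)) (initial P)) (List.length-map (at (+ k)) (final P)))))

  members-All : ∀ {P : Shape Affine → Set} {Q : Shape ℤ → Set} → (∀ A s → P s → Q (at A s)) → ∀ F →
                All P (running F) → All P (initial F) → All P (final F) → All Q (members F)
  members-All sound F pr pi pf = All.++⁺
    (All.concat⁺ (All.map⁺ (All.map (λ {s} p → All.map⁺ {f = λ A → at (+ A) s}
        (All.universal (λ A → sound (+ A) s p) (upTo k))) pr)))
    (All.++⁺ (All.map⁺ (All.map (λ {s} → sound (+ 0) s) pi)) (All.map⁺ (All.map (λ {s} → sound (+ k) s) pf)))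

-- Searching a family for matches, uniformly in k

Item : Set
Item = Affine × Affine

_⟪_⟫ : Item → Affine → Item
(f , g) ⟪ h ⟫ = f ⟨ h ⟩ , g ⟨ h ⟩

module Search (Match : Shape Affine → Item → Set) (match? : ∀ s i → Dec (Match s i)) (P : Family) where

  -- The match of i at A is the running member at A − 1, or an initial one if A = 0.
  Late : Item → Set
  Late i = Any (λ s → Match s (i ⟪ 𝟎 ⟫)) (initial P) × Any (λ s → Match s (i ⟪ 𝐀+1 ⟫)) (running P)

  -- Found certifies a match for each A < k, uniformly in k, and FoundLast a match for A = k.
  Found FoundLast : Item → Set
  Found i = Any (λ s → Match s i) (running P) ⊎ Late i
  FoundLast i = Any (λ s → Match (mapShape (_⟨ 𝐤 ⟩) s) (i ⟪ 𝐤 ⟫)) (final P) ⊎ Late i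

  late? : ∀ i → Dec (Late i)
  late? i = Any.any? (λ s → match? s _) (initial P) ×-dec Any.any? (λ s → match? s _) (running P)

  found? : ∀ i → Dec (Found i)
  found? i = Any.any? (λ s → match? s i) (running P) ⊎-dec late? i

  foundLast? : ∀ i → Dec (FoundLast i)
  foundLast? i = Any.any? (λ s → match? _ _) (final P) ⊎-dec late? i

  module Soundness (k : ℕ) (Q : Shape ℤ → ℤ × ℤ → Set)
    (sound : ∀ A s f g → Match s (f , g) → Q (Members.at k A s) (Evaluation.eval (+ k) A f , Evaluation.eval (+ k) A g)) where

    open Members k

    Hit : ℤ → Item → Set
    Hit A (f , g) = ∃ λ s → s ∈ members P × Q s (eval A f , eval A g)

    private
      running∈ : ∀ {s} A → A ℕ.< k → s ∈ running P → at (+ A) s ∈ members P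
      running∈ A A<k s∈ = ∈-++⁺ˡ (∈-concatMap⁺ copies
        (Any.map (λ { refl → ∈-map⁺ _ (∈-upTo⁺ A<k) }) s∈))

      initial∈ : ∀ {s} → s ∈ initial P → at (+ 0) s ∈ members P
      initial∈ s∈ = ∈-++⁺ʳ (concatMap copies (running P)) (∈-++⁺ˡ (∈-map⁺ (at (+ 0)) s∈))

      final∈ : ∀ {s} → s ∈ final P → at (+ k) s ∈ members P
      final∈ s∈ = ∈-++⁺ʳ (concatMap copies (running P)) (∈-++⁺ʳ (map (at (+ 0)) (initial P)) (∈-map⁺ (at (+ k)) s∈))

      at-⟨⟩ : ∀ A g s → at A (mapShape (_⟨ g ⟩) s) ≡ at (eval A g) s
      at-⟨⟩ A g (shape c ls) = cong₂ shape (eval-⟨⟩ A c g)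
        (trans (sym (Vec.map-∘ (eval A) (_⟨ g ⟩) ls)) (Vec.map-cong (λ f → eval-⟨⟩ A f g) ls))

      Q-⟪⟫ : ∀ {s} A g i → Q s (eval A (proj₁ (i ⟪ g ⟫)) , eval A (proj₂ (i ⟪ g ⟫))) →
             Q s (eval (eval A g) (proj₁ i) , eval (eval A g) (proj₂ i))
      Q-⟪⟫ {s} A g (f₁ , f₂) = subst (Q s) (cong₂ _,_ (eval-⟨⟩ A f₁ g) (eval-⟨⟩ A f₂ g))

      late : ∀ i A → A ℕ.≤ k → Late i → Hit (+ A) i
      late i zero _ (m , _) =
        let s , s∈ , q = find m
        in at (+ 0) s , initial∈ s∈ ,
           subst (λ A → Q (at (+ 0) s) (eval A (proj₁ i) , eval A (proj₂ i))) (eval-𝟎 (+ 0))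
               (Q-⟪⟫ (+ 0) 𝟎 i (sound (+ 0) s _ _ q))
      -- The running member at A is used, one before the item. It exists because A < k, so this also
      -- reaches the item at k itself, as `foundLast⇒hit` requires.
      late i (suc A) A<k (_ , m) =
        let s , s∈ , q = find m
        in at (+ A) s , running∈ A A<k s∈ ,
           subst (λ B → Q (at (+ A) s) (eval B (proj₁ i) , eval B (proj₂ i))) (eval-𝐀+1 (+ A))
               (Q-⟪⟫ (+ A) 𝐀+1 i (sound (+ A) s _ _ q))

    found⇒hit : ∀ i A → A ℕ.< k → Found i → Hit (+ A) i
    found⇒hit i A A<k (inj₁ m) = let s , s∈ , q = find m in at (+ A) s , running∈ A A<k s∈ , sound (+ A) s _ _ q
    found⇒hit i A A<k (inj₂ l) = late i A (ℕ.<⇒≤ A<k) l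

    foundLast⇒hit : ∀ i → FoundLast i → Hit (+ k) i
    foundLast⇒hit i (inj₁ m) =
      let s , s∈ , q = find m
      in at (+ k) s , final∈ s∈ ,
         -- After the substitution of `𝐤` no form depends on A, so they may be evaluated at 0.
         subst₂ (λ B C → Q (at B s) (eval C (proj₁ i) , eval C (proj₂ i))) (eval-𝐤 (+ 0)) (eval-𝐤 (+ 0))
           (Q-⟪⟫ (+ 0) 𝐤 i (subst (λ t → Q t (eval (+ 0) (proj₁ (i ⟪ 𝐤 ⟫)) , eval (+ 0) (proj₂ (i ⟪ 𝐤 ⟫))))
               (at-⟨⟩ (+ 0) 𝐤 s) (sound (+ 0) _ _ _ q)))
    foundLast⇒hit i (inj₂ l) = late i k ℕ.≤-refl l

-- Division into blocks

block-up : ∀ w .{{_ : NonZero w}} {k r} → r ℕ.< k ℕ.* w →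
           ∃ λ A → ∃ λ (ρ : Fin w) → A ℕ.< k × + r ≡ + toℕ ρ + + A * + w
block-up w {k} {r} r< = r ℕ./ w , fromℕ< (ℕ.m%n<n r w) , ℕ.m<n*o⇒m/o<n r< ,
  trans (a≡a%ℕn+[a/ℕn]*n (+ r) w) (cong (λ n → + n + + (r ℕ./ w) * + w) (sym (Fin.toℕ-fromℕ< (ℕ.m%n<n r w))))

-- The reflection of r to k w - 1 - r reduces this to `block-up`. It serves the ranges in which
-- positions decrease as A grows.
block-down : ∀ w .{{_ : NonZero w}} {k r} → r ℕ.< k ℕ.* w →
             ∃ λ A → ∃ λ (ρ : Fin w) → A ℕ.< k × + r ≡ + k * + w - + 1 - + toℕ ρ - + A * + w
block-down w {k} {r} r< with block-up w {k} {k ℕ.* w ℕ.∸ suc r} (ℕ.∸-monoʳ-< (s≤s z≤n) r<)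
... | A , ρ , A<k , eq = A , ρ , A<k , (begin
  + r
    ≡⟨ solve 2 (λ r u → r := u :+ (con (+ 1) :+ r) :- con (+ 1) :- u) refl (+ r) (+ u) ⟩
  + u + + suc r - + 1 - + u
    ≡⟨ cong₂ (λ n z → + n - + 1 - z) (ℕ.m∸n+n≡m r<) eq ⟩
  + (k ℕ.* w) - + 1 - (+ toℕ ρ + + A * + w)
    ≡⟨ cong (λ n → n - + 1 - (+ toℕ ρ + + A * + w)) (ℤ.pos-* k w) ⟩
  + k * + w - + 1 - (+ toℕ ρ + + A * + w)
    ≡⟨ solve 3 (λ n ρ a → n :- con (+ 1) :- (ρ :+ a) := n :- con (+ 1) :- ρ :- a) refl (+ k * + w) (+ toℕ ρ) (+ A * + w) ⟩
  + k * + w - + 1 - + toℕ ρ - + A * + w ∎)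
  where
  open ≡-Reasoning
  open ℤ-Solver
  u = k ℕ.* w ℕ.∸ suc r

split-+ : ∀ a {b r} → r ℕ.< a ℕ.+ b → r ℕ.< a ⊎ ∃ λ r′ → r′ ℕ.< b × r ≡ a ℕ.+ r′
split-+ a {b} {r} r< with r ℕ.<? a
... | yes r<a = inj₁ r<a
... | no r≮a = inj₂ (r ℕ.∸ a , ℕ.+-cancelˡ-< a _ _ (subst (ℕ._< a ℕ.+ b) (sym eq) r<) , sym eq)
  where eq = ℕ.m+[n∸m]≡n (ℕ.≮⇒≥ r≮a)

-- Designs

-- There are 6 `m₀` + 60 k vertices, hence `m₀` + 10 k stars in a factor. The near points are the
-- positions from - 5 k - `near` to - 5 k, and the far points are the first `far` positions after 25
-- k.
record Design : Set where
  field
    m₀ near far : ℕ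
    base tiles : Family

module Certificates (D : Design) where
  open Design D public

  PointMatch : Shape Affine → Item → Set
  PointMatch s (f , _) = f ∈ points s

  pointMatch? : ∀ s i → Dec (PointMatch s i)
  pointMatch? s (f , _) = Any.any? (f ≟_) (points s)

  order : Affine
  order = affine (+ (m₀ ℕ.* 6)) (+ 60) (+ 0)

  Arc : Affine → Affine → Item → Set
  Arc a b (p , d) = (b ⊖ a ≡ d ⊎ b ⊖ a ≡ d ⊖ order) × 2 ∣ᶠ (a ⊖ p)

  arc? : ∀ a b i → Dec (Arc a b i)
  arc? a b (p , d) = (b ⊖ a ≟ d ⊎-dec b ⊖ a ≟ d ⊖ order) ×-dec 2 ∣ᶠ? (a ⊖ p)

  ArcMatch : Shape Affine → Item → Set
  ArcMatch (shape c ls) i = Any (λ l → Arc c l i ⊎ Arc l c i) (toList ls)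

  arcMatch? : ∀ s i → Dec (ArcMatch s i)
  arcMatch? (shape c ls) i = Any.any? (λ l → arc? c l i ⊎-dec arc? l c i) (toList ls)

  open Search PointMatch pointMatch? base using () renaming
    (Found to HasPoint; FoundLast to HasLastPoint; found? to hasPoint?; foundLast? to hasLastPoint?) public
  open Search ArcMatch arcMatch? base using () renaming
    (Found to BaseArc; FoundLast to LastBaseArc; found? to baseArc?; foundLast? to lastBaseArc?) public
  open Search ArcMatch arcMatch? tiles using () renaming
    (Found to TileArc; FoundLast to LastTileArc; found? to tileArc?; foundLast? to lastTileArc?) public

  -- Six points in six different classes modulo 6: the translates by multiples of 6 then tile ℤ/v,
  -- as 6 divides v. Divisibility of the coefficients makes this uniform in k and A.
  Tile : Shape Affine → Set
  Tile s = (ρ : Fin 6) → Any (λ f → 6 ∣ᶠ (f ⊖ hub s ⊖ affine (+ toℕ ρ) (+ 0) (+ 0))) (points s)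

  tile? : ∀ s → Dec (Tile s)
  tile? s = Fin.all? λ ρ → Any.any? (λ f → 6 ∣ᶠ? _) (points s)

  -- Around ℤ/v one meets the left leaves, the left hubs, the near points, the right hubs, the right leaves
  -- and the far points.  The near and far points are the continuations of the hubs and leaves to A = k.
  rightLeaf rightHub leftHub leftLeaf nearPoint farPoint : ℕ → Item
  rightLeaf ρ = affine (+ 1 + + ρ) (+ 0) (+ 25) , 𝟎
  rightHub  ρ = affine (- + ρ) (+ 0) (- + 5) , 𝟎
  leftHub   ρ = affine (+ ρ - + near) (- + 10) (+ 5) , 𝟎
  leftLeaf  ρ = affine (- + near - + 1 - + ρ) (- + 10) (- + 25) , 𝟎
  nearPoint ρ = affine (+ ρ - + near) (+ 0) (- + 5) , 𝟎
  farPoint    = rightLeaf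

  -- The pairs {x , x + d} with x ≡ b + A modulo 2 and d = 30 A + 1 + ρ
  pair : ℕ → ℕ → Item
  pair b ρ = affine (+ b) (+ 0) (+ 1) , affine (+ 1 + + ρ) (+ 0) (+ 30)

  record Certificate : Set where
    constructor certificate
    field
      right-leaves : ∀ (ρ : Fin 25) → HasPoint (rightLeaf (toℕ ρ))
      right-hubs   : ∀ (ρ : Fin 5) → HasPoint (rightHub (toℕ ρ))
      left-hubs    : ∀ (ρ : Fin 5) → HasPoint (leftHub (toℕ ρ))
      left-leaves  : ∀ (ρ : Fin 25) → HasPoint (leftLeaf (toℕ ρ))
      near-points  : ∀ (ρ : Fin (suc near)) → HasLastPoint (nearPoint (toℕ ρ))
      far-points   : ∀ (ρ : Fin far) → HasLastPoint (farPoint (toℕ ρ))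
      pairs        : ∀ (b : Fin 2) (ρ : Fin 30) → BaseArc (pair (toℕ b) (toℕ ρ)) ⊎ TileArc (pair (toℕ b) (toℕ ρ))
      -- These distances run from 30 k + 1 to 30 k + 3 `m₀` - 1 = v / 2 - 1; the distance v / 2
      -- belongs to the matching.
      last-pairs   : ∀ (b : Fin 2) (ρ : Fin (m₀ ℕ.* 3 ℕ.∸ 1)) → LastBaseArc (pair (toℕ b) (toℕ ρ)) ⊎ LastTileArc
          (pair (toℕ b) (toℕ ρ))
      running-tile : All Tile (running tiles)
      initial-tile : All Tile (initial tiles)
      final-tile   : All Tile (final tiles)
      -- The ranges of hubs and leaves contain 60 k points in all, so the near and far points have
      -- to supply the other 6 `m₀`.
      points-total : suc near ℕ.+ far ≡ m₀ ℕ.* 6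
      base-length  : length (running base) ≡ 10
      base-length₀ : length (initial base) ℕ.+ length (final base) ≡ m₀
      -- With v / 2 base factors and three factors for each of T tiled stars, the edge count amounts
      -- to m = 2 + 5 T. Here m is `m₀` + 10 k, and T is 2 k plus the number of initial and final
      -- tiles.
      tile-length  : length (running tiles) ≡ 2
      tile-length₀ : 2 ℕ.+ (length (initial tiles) ℕ.+ length (final tiles)) ℕ.* 5 ≡ m₀

  certificate? : Dec Certificate
  certificate? = map′
    (λ (a , b , c , d , e , f , g , h , i , j , k , l , m , n , o , p) → certificate a b c d e f g h i j k l m n o p)
    (λ (certificate a b c d e f g h i j k l m n o p) → a , b , c , d , e , f , g , h , i , j , k , l , m , n , o , p)
    (     Fin.all? {n = 25} (λ ρ → hasPoint? (rightLeaf (toℕ ρ)))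
    ×-dec Fin.all? {n = 5} (λ ρ → hasPoint? (rightHub (toℕ ρ)))
    ×-dec Fin.all? {n = 5} (λ ρ → hasPoint? (leftHub (toℕ ρ)))
    ×-dec Fin.all? {n = 25} (λ ρ → hasPoint? (leftLeaf (toℕ ρ)))
    ×-dec Fin.all? {n = suc near} (λ ρ → hasLastPoint? (nearPoint (toℕ ρ)))
    ×-dec Fin.all? {n = far} (λ ρ → hasLastPoint? (farPoint (toℕ ρ)))
    ×-dec Fin.all? {n = 2} (λ b → Fin.all? {n = 30} λ ρ → baseArc? (pair (toℕ b) (toℕ ρ)) ⊎-dec tileArc? (pair (toℕ b) (toℕ ρ)))
    ×-dec Fin.all? {n = 2} (λ b → Fin.all? {n = m₀ ℕ.* 3 ℕ.∸ 1} λ ρ → lastBaseArc? (pair (toℕ b) (toℕ ρ)) ⊎-dec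
        lastTileArc? (pair (toℕ b) (toℕ ρ)))
    ×-dec All.all? tile? (running tiles)
    ×-dec All.all? tile? (initial tiles)
    ×-dec All.all? tile? (final tiles)
    ×-dec suc near ℕ.+ far ℕ.≟ m₀ ℕ.* 6
    ×-dec length (running base) ℕ.≟ 10
    ×-dec length (initial base) ℕ.+ length (final base) ℕ.≟ m₀
    ×-dec length (running tiles) ℕ.≟ 2
    ×-dec 2 ℕ.+ (length (initial tiles) ℕ.+ length (final tiles)) ℕ.* 5 ℕ.≟ m₀)

-- From a certificate to a decomposition for every k

module Construction (D : Design) (C : Certificates.Certificate D) (k : ℕ) where
  open Certificates D
  open Certificate C
  open Members k
  open ℤ-Solver

  m v : ℕ
  m = m₀ ℕ.+ k ℕ.* 10
  v = m ℕ.* 3 ℕ.* 2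

  instance
    m₀≢0 : NonZero m₀
    m₀≢0 = subst NonZero tile-length₀ _

    m≢0 : NonZero m
    m≢0 = ℕ.≢-nonZero λ eq → ℕ.≢-nonZero⁻¹ m₀ (ℕ.m+n≡0⇒m≡0 m₀ eq)

    m*3≢0 : NonZero (m ℕ.* 3)
    m*3≢0 = ℕ.m*n≢0 m 3

    v≢0 : NonZero v
    v≢0 = ℕ.m*n≢0 (m ℕ.* 3) 2

  mℤ : + m ≡ + m₀ + + k * + 10
  mℤ = cong (_+_ (+ m₀)) (ℤ.pos-* k 10)

  vℤ : + v ≡ + m * + 3 * + 2
  vℤ = trans (ℤ.pos-* (m ℕ.* 3) 2) (cong (_* + 2) (ℤ.pos-* m 3))

  eval-order : ∀ A → eval A order ≡ + v
  eval-order A = begin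
    + (m₀ ℕ.* 6) + + 60 * + k + + 0 * A   ≡⟨ cong (λ n → n + + 60 * + k + + 0 * A) (ℤ.pos-* m₀ 6) ⟩
    + m₀ * + 6 + + 60 * + k + + 0 * A
      ≡⟨ solve 3 (λ m k A → m :* con (+ 6) :+ con (+ 60) :* k :+ con (+ 0) :* A := (m :+ k :* con (+ 10)) :* con
          (+ 3) :* con (+ 2)) refl (+ m₀) (+ k) A ⟩
    (+ m₀ + + k * + 10) * + 3 * + 2       ≡⟨ cong (λ n → n * + 3 * + 2) mℤ ⟨
    + m * + 3 * + 2                       ≡⟨ vℤ ⟨
    + v                                   ∎
    where open ≡-Reasoning

  -- The base factor and the tilings

  starAt : ℤ → Shape ℤ → Star5 v
  starAt t (shape c ls) = star (pt v (c + t)) (Vec.map (λ l → pt v (l + t)) ls)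

  starVertices-starAt : ∀ t s → starVertices (starAt t s) ≡ map (λ f → pt v (f + t)) (points s)
  starVertices-starAt t (shape c ls) = cong (pt v (c + t) ∷_) (Vec.toList-map _ ls)

  starAt-period : ∀ {t u} q s → t ≡ u + q * + v → starAt t s ≡ starAt u s
  starAt-period {t} {u} q (shape c ls) eq = cong₂ star (shift c) (Vec.map-cong shift ls)
    where
    shift : ∀ f → pt v (f + t) ≡ pt v (f + u)
    shift f = pt-period v {f + t} {f + u} q (trans (cong (_+_ f) eq) (sym (ℤ.+-assoc f u (q * + v))))

  baseFactor : ℕ → List (Star5 v)
  baseFactor j = map (starAt (+ 2 * + j)) (members base)

  tileFactor : Shape ℤ → ℕ → List (Star5 v)
  tileFactor s j = map (λ e → starAt (+ 2 * + j + + 6 * + e) s) (upTo m)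

  factors : List (List (Star5 v))
  factors = map baseFactor (upTo (m ℕ.* 3)) ++ concatMap (λ s → map (tileFactor s) (upTo 3)) (members tiles)

  factors-all : ∀ {p} {P : List (Star5 v) → Set p} → (∀ j → P (baseFactor j)) →
                (∀ s → s ∈ members tiles → ∀ j → P (tileFactor s j)) → All P factors
  factors-all onBase onTiles = All.++⁺ (All.map⁺ (All.universal onBase (upTo (m ℕ.* 3))))
    (All.concat⁺ (All.map⁺ (All.tabulate λ {s} s∈ → All.map⁺ {f = tileFactor s} (All.universal (onTiles s s∈) (upTo 3)))))

  length-baseFactor : ∀ j → length (baseFactor j) ≡ m
  length-baseFactor j = begin
    length (baseFactor j)     ≡⟨ List.length-map _ (members base) ⟩
    length (members base)     ≡⟨ length-members base ⟩
    length (running base) ℕ.* k ℕ.+ (length (initial base) ℕ.+ length (final base))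
                              ≡⟨ cong₂ (λ x y → x ℕ.* k ℕ.+ y) base-length base-length₀ ⟩
    10 ℕ.* k ℕ.+ m₀           ≡⟨ ℕ.+-comm (10 ℕ.* k) m₀ ⟩
    m₀ ℕ.+ 10 ℕ.* k           ≡⟨ cong (m₀ ℕ.+_) (ℕ.*-comm 10 k) ⟩
    m ∎
    where open ≡-Reasoning

  length-tileFactor : ∀ s j → length (tileFactor s j) ≡ m
  length-tileFactor s j = trans (List.length-map _ (upTo m)) (List.length-upTo m)

  length-factors : v ℕ.+ (v ℕ.+ length factors ℕ.* (m ℕ.* 10)) ≡ v ℕ.* v
  length-factors = begin
    v ℕ.+ (v ℕ.+ length factors ℕ.* (m ℕ.* 10)) ≡⟨ cong (λ n → v ℕ.+ (v ℕ.+ n ℕ.* (m ℕ.* 10))) len ⟩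
    v ℕ.+ (v ℕ.+ (m ℕ.* 3 ℕ.+ (2 ℕ.* k ℕ.+ t) ℕ.* 3) ℕ.* (m ℕ.* 10))
      -- Writing `m₀` as 2 + 5 t turns the count into a polynomial identity in t and k.
      ≡⟨ cong (λ m₀ → count (m₀ ℕ.+ k ℕ.* 10)) tile-length₀ ⟨
    count (2 ℕ.+ t ℕ.* 5 ℕ.+ k ℕ.* 10)
      ≡⟨ S.solve 2 (λ t k → let m = S.con 2 S.:+ t S.:* S.con 5 S.:+ k S.:* S.con 10; v = m S.:* S.con 3 S.:* S.con 2 in
           v S.:+ (v S.:+ (m S.:* S.con 3 S.:+ (S.con 2 S.:* k S.:+ t) S.:* S.con 3) S.:* (m S.:* S.con 10)) S.:= v
               S.:* v) refl t k ⟩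
    square (2 ℕ.+ t ℕ.* 5 ℕ.+ k ℕ.* 10)
      ≡⟨ cong (λ m₀ → square (m₀ ℕ.+ k ℕ.* 10)) tile-length₀ ⟩
    v ℕ.* v ∎
    where
    open ≡-Reasoning
    module S = ℕ-Solver
    t = length (initial tiles) ℕ.+ length (final tiles)
    square count : ℕ → ℕ
    square m = m ℕ.* 3 ℕ.* 2 ℕ.* (m ℕ.* 3 ℕ.* 2)
    count m = m ℕ.* 3 ℕ.* 2 ℕ.+ (m ℕ.* 3 ℕ.* 2 ℕ.+ (m ℕ.* 3 ℕ.+ (2 ℕ.* k ℕ.+ t) ℕ.* 3) ℕ.* (m ℕ.* 10))
    len : length factors ≡ m ℕ.* 3 ℕ.+ (2 ℕ.* k ℕ.+ t) ℕ.* 3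
    len = trans (List.length-++ (map baseFactor (upTo (m ℕ.* 3)))) (cong₂ ℕ._+_
      (trans (List.length-map baseFactor (upTo (m ℕ.* 3))) (List.length-upTo (m ℕ.* 3)))
      (trans (length-concatMap _ (members tiles) (All.universal (λ _ → refl) _))
        (cong (ℕ._* 3) (trans (length-members tiles) (cong (λ n → n ℕ.* k ℕ.+ t) tile-length)))))

  -- Every vertex occurs in every factor

  cover : ∀ x t s f q → f ∈ points s → + toℕ x ≡ f + t + q * + v → x ∈ starVertices (starAt t s)
  cover x t s f q f∈ eq = subst₂ _∈_ (trans (sym (pt-period v {+ toℕ x} {f + t} q eq)) (pt-toℕ v x))
      (sym (starVertices-starAt t s)) (∈-map⁺ (λ f → pt v (f + t)) f∈)

  private
    module P = Search.Soundness PointMatch pointMatch? base k (λ s (z , _) → z ∈ points s)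
      (λ A s f g f∈ → subst (eval A f ∈_) (sym (points-map (eval A) s)) (∈-map⁺ (eval A) f∈))

  -- The leftmost point of the base factor is - 35 k - `near`; this shift brings it to 0, so that
  -- the base factor fills the interval from 0 to v - 1.
  offset : ℤ
  offset = + k * + 35 + + near

  Located : ℤ → Set
  Located z = ∃₂ λ s f → s ∈ members base × f ∈ points s × z ≡ f + offset

  locate : ∀ {z} A i → P.Hit A i → z ≡ eval A (proj₁ i) + offset → Located z
  locate A i (s , s∈ , f∈) eq = s , eval A (proj₁ i) , s∈ , f∈ , eq

  private
    K N : ℤ
    K = + k
    N = + near

  in-left-leaves : ∀ {r} → r ℕ.< k ℕ.* 25 → Located (+ r)
  in-left-leaves r< with block-down 25 {k} r<
  ... | A , ρ , A<k , eq = locate (+ A) (leftLeaf (toℕ ρ)) (P.found⇒hit (leftLeaf (toℕ ρ)) A A<k (left-leaves ρ))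
    (trans eq (solve 4 (λ k n ρ A → k :* con (+ 25) :- con (+ 1) :- ρ :- A :* con (+ 25)
      := (:- n :- con (+ 1) :- ρ) :+ con (- + 10) :* k :+ con (- + 25) :* A :+ (k :* con (+ 35) :+ n)) refl K N
          (+ toℕ ρ) (+ A)))

  in-left-hubs : ∀ {r} → r ℕ.< k ℕ.* 5 → Located (K * + 25 + + r)
  in-left-hubs r< with block-up 5 {k} r<
  ... | A , ρ , A<k , eq = locate (+ A) (leftHub (toℕ ρ)) (P.found⇒hit (leftHub (toℕ ρ)) A A<k (left-hubs ρ))
    (trans (cong (_+_ (K * + 25)) eq) (solve 4 (λ k n ρ A → k :* con (+ 25) :+ (ρ :+ A :* con (+ 5))
      := (ρ :- n) :+ con (- + 10) :* k :+ con (+ 5) :* A :+ (k :* con (+ 35) :+ n)) refl K N (+ toℕ ρ) (+ A)))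

  in-near-points : ∀ {r} → r ℕ.< suc near → Located (K * + 30 + + r)
  in-near-points r< = locate K (nearPoint ρ) (P.foundLast⇒hit (nearPoint ρ) (near-points (fromℕ< r<)))
    (trans (cong (λ r → K * + 30 + + r) (sym (Fin.toℕ-fromℕ< r<)))
      (solve 3 (λ k n ρ → k :* con (+ 30) :+ ρ
        := (ρ :- n) :+ con (+ 0) :* k :+ con (- + 5) :* k :+ (k :* con (+ 35) :+ n)) refl K N (+ ρ)))
    where ρ = toℕ (fromℕ< r<)

  in-right-hubs : ∀ {r} → r ℕ.< k ℕ.* 5 → Located (K * + 30 + (+ 1 + N) + + r)
  in-right-hubs r< with block-down 5 {k} r<
  ... | A , ρ , A<k , eq = locate (+ A) (rightHub (toℕ ρ)) (P.found⇒hit (rightHub (toℕ ρ)) A A<k (right-hubs ρ))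
    (trans (cong (_+_ (K * + 30 + (+ 1 + N))) eq) (solve 4 (λ k n ρ A → k :* con (+ 30) :+ (con (+ 1) :+ n) :+
        (k :* con (+ 5) :- con (+ 1) :- ρ :- A :* con (+ 5))
      := (:- ρ) :+ con (+ 0) :* k :+ con (- + 5) :* A :+ (k :* con (+ 35) :+ n)) refl K N (+ toℕ ρ) (+ A)))

  in-right-leaves : ∀ {r} → r ℕ.< k ℕ.* 25 → Located (K * + 35 + (+ 1 + N) + + r)
  in-right-leaves r< with block-up 25 {k} r<
  ... | A , ρ , A<k , eq = locate (+ A) (rightLeaf (toℕ ρ)) (P.found⇒hit (rightLeaf (toℕ ρ)) A A<k (right-leaves ρ))
    (trans (cong (_+_ (K * + 35 + (+ 1 + N))) eq) (solve 4 (λ k n ρ A → k :* con (+ 35) :+ (con (+ 1) :+ n) :+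
        (ρ :+ A :* con (+ 25))
      := (con (+ 1) :+ ρ) :+ con (+ 0) :* k :+ con (+ 25) :* A :+ (k :* con (+ 35) :+ n)) refl K N (+ toℕ ρ) (+ A)))

  in-far-points : ∀ {r} → r ℕ.< far → Located (K * + 60 + (+ 1 + N) + + r)
  in-far-points r< = locate K (farPoint ρ) (P.foundLast⇒hit (farPoint ρ) (far-points (fromℕ< r<)))
    (trans (cong (λ r → K * + 60 + (+ 1 + N) + + r) (sym (Fin.toℕ-fromℕ< r<)))
      (solve 3 (λ k n ρ → k :* con (+ 60) :+ (con (+ 1) :+ n) :+ ρ
        := (con (+ 1) :+ ρ) :+ con (+ 0) :* k :+ con (+ 25) :* k :+ (k :* con (+ 35) :+ n)) refl K N (+ ρ)))
    where ρ = toℕ (fromℕ< r<)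

  window-length : v ≡ k ℕ.* 25 ℕ.+ (k ℕ.* 5 ℕ.+ (suc near ℕ.+ (k ℕ.* 5 ℕ.+ (k ℕ.* 25 ℕ.+ far))))
  window-length = begin
    v ≡⟨ S.solve 2 (λ m k → (m S.:+ k S.:* S.con 10) S.:* S.con 3 S.:* S.con 2 S.:= m S.:* S.con 6 S.:+ k S.:* S.con
        60) refl m₀ k ⟩
    m₀ ℕ.* 6 ℕ.+ k ℕ.* 60  ≡⟨ cong (ℕ._+ k ℕ.* 60) points-total ⟨
    suc near ℕ.+ far ℕ.+ k ℕ.* 60
      ≡⟨ S.solve 3 (λ n f k → n S.:+ f S.:+ k S.:* S.con 60 S.:= k S.:* S.con 25 S.:+
          (k S.:* S.con 5 S.:+ (n S.:+ (k S.:* S.con 5 S.:+ (k S.:* S.con 25 S.:+ f))))) refl (suc near) far k ⟩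
    k ℕ.* 25 ℕ.+ (k ℕ.* 5 ℕ.+ (suc near ℕ.+ (k ℕ.* 5 ℕ.+ (k ℕ.* 25 ℕ.+ far)))) ∎
    where
    open ≡-Reasoning
    module S = ℕ-Solver

  -- The six ranges, taken in their order around ℤ/v, have lengths adding up to v, so subtracting
  -- these lengths one after another locates r.
  window : ∀ r → r ℕ.< v → Located (+ r)
  window r r<v = [ in-left-leaves , (λ (r₁ , r₁< , e₁) →
    [ (λ r₁<a → subst Located (sym (c₁ e₁)) (in-left-hubs r₁<a)) , (λ (r₂ , r₂< , e₂) →
    [ (λ r₂<a → subst Located (sym (c₂ e₁ e₂)) (in-near-points r₂<a)) , (λ (r₃ , r₃< , e₃) →
    [ (λ r₃<a → subst Located (sym (c₃ e₁ e₂ e₃)) (in-right-hubs r₃<a)) , (λ (r₄ , r₄< , e₄) →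
    [ (λ r₄<a → subst Located (sym (c₄ e₁ e₂ e₃ e₄)) (in-right-leaves r₄<a)) , (λ (r₅ , r₅< , e₅) →
        subst Located (sym (c₅ e₁ e₂ e₃ e₄ e₅)) (in-far-points r₅<))
    ]′ (split-+ (k ℕ.* 25) r₄<)) ]′ (split-+ (k ℕ.* 5) r₃<)) ]′ (split-+ (suc near) r₂<)) ]′ (split-+ (k ℕ.* 5) r₁<)) ]′
    (split-+ (k ℕ.* 25) (subst (r ℕ.<_) window-length r<v))
    where
    split : ∀ {r r′} a → r ≡ k ℕ.* a ℕ.+ r′ → + r ≡ K * + a + + r′
    split {r′ = r′} a eq = trans (cong +_ eq) (cong (_+ + r′) (ℤ.pos-* k a))
    c₁ : ∀ {r₁} → r ≡ k ℕ.* 25 ℕ.+ r₁ → + r ≡ K * + 25 + + r₁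
    c₁ = split 25
    c₂ : ∀ {r₁ r₂} → r ≡ k ℕ.* 25 ℕ.+ r₁ → r₁ ≡ k ℕ.* 5 ℕ.+ r₂ → + r ≡ K * + 30 + + r₂
    c₂ {_} {r₂} e₁ e₂ = trans (c₁ e₁) (trans (cong (_+_ (K * + 25)) (split 5 e₂))
      (solve 2 (λ k r → k :* con (+ 25) :+ (k :* con (+ 5) :+ r) := k :* con (+ 30) :+ r) refl K (+ r₂)))
    c₃ : ∀ {r₁ r₂ r₃} → r ≡ k ℕ.* 25 ℕ.+ r₁ → r₁ ≡ k ℕ.* 5 ℕ.+ r₂ → r₂ ≡ suc near ℕ.+ r₃ → + r ≡ K * + 30 + (+ 1 + N) + + r₃
    c₃ {r₃ = r₃} e₁ e₂ e₃ = trans (c₂ e₁ e₂) (trans (cong (λ r → K * + 30 + + r) e₃)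
        (sym (ℤ.+-assoc (K * + 30) (+ 1 + N) (+ r₃))))
    c₄ : ∀ {r₁ r₂ r₃ r₄} → r ≡ k ℕ.* 25 ℕ.+ r₁ → r₁ ≡ k ℕ.* 5 ℕ.+ r₂ → r₂ ≡ suc near ℕ.+ r₃ → r₃ ≡ k ℕ.* 5 ℕ.+ r₄ →
         + r ≡ K * + 35 + (+ 1 + N) + + r₄
    c₄ {r₄ = r₄} e₁ e₂ e₃ e₄ = trans (c₃ e₁ e₂ e₃) (trans (cong (_+_ (K * + 30 + (+ 1 + N))) (split 5 e₄))
      (solve 3 (λ k n r → k :* con (+ 30) :+ n :+ (k :* con (+ 5) :+ r) := k :* con (+ 35) :+ n :+ r) refl K (+ 1 + N) (+ r₄)))
    c₅ : ∀ {r₁ r₂ r₃ r₄ r₅} → r ≡ k ℕ.* 25 ℕ.+ r₁ → r₁ ≡ k ℕ.* 5 ℕ.+ r₂ → r₂ ≡ suc near ℕ.+ r₃ → r₃ ≡ k ℕ.* 5 ℕ.+ r₄ →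
         r₄ ≡ k ℕ.* 25 ℕ.+ r₅ → + r ≡ K * + 60 + (+ 1 + N) + + r₅
    c₅ {r₅ = r₅} e₁ e₂ e₃ e₄ e₅ = trans (c₄ e₁ e₂ e₃ e₄) (trans (cong (_+_ (K * + 35 + (+ 1 + N))) (split 25 e₅))
      (solve 3 (λ k n r → k :* con (+ 35) :+ n :+ (k :* con (+ 25) :+ r) := k :* con (+ 60) :+ n :+ r) refl K (+ 1 + N) (+ r₅)))

  private
    unshift : ∀ x t o f r q → x - t + o ≡ r + q → r ≡ f + o → x ≡ f + t + q
    unshift x t o f r q eq eq′ = begin
      x                  ≡⟨ solve 3 (λ x t o → x := x :- t :+ o :+ t :- o) refl x t o ⟩
      x - t + o + t - o  ≡⟨ cong (λ w → w + t - o) (trans eq (cong (_+ q) eq′)) ⟩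
      f + o + q + t - o  ≡⟨ solve 4 (λ f o q t → f :+ o :+ q :+ t :- o := f :+ t :+ q) refl f o q t ⟩
      f + t + q          ∎
      where open ≡-Reasoning

  -- Undoing the translation by t, shifting by `offset` and reducing modulo v brings x into the
  -- window.
  base-covers : ∀ t x → Any (λ s → x ∈ starVertices (starAt t s)) (members base)
  base-covers t x = found (window (w %ℕ v) (n%ℕd<d w v))
    where
    w = + toℕ x - t + offset
    found : Located (+ (w %ℕ v)) → Any (λ s → x ∈ starVertices (starAt t s)) (members base)
    found (s , f , s∈ , f∈ , eq) = lose s∈ (cover x t s f (w /ℕ v) f∈
      (unshift (+ toℕ x) t offset f (+ (w %ℕ v)) ((w /ℕ v) * + v) (a≡a%ℕn+[a/ℕn]*n w v) eq))

  baseFactor-covers : ∀ j x → x ∈ concatMap starVertices (baseFactor j)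
  baseFactor-covers j x = ∈-concatMap⁺ starVertices (Any.map⁺ (base-covers (+ 2 * + j) x))

  Transversal : Shape ℤ → Set
  Transversal s = (ρ : Fin 6) → Any (λ f → ∃ λ h → f - hub s - + toℕ ρ ≡ + 6 * h) (points s)

  tile⇒transversal : ∀ A s → Tile s → Transversal (at A s)
  tile⇒transversal A s tile ρ = subst (Any _) (sym (points-map (eval A) s)) (Any.map⁺ (Any.map (λ {f} → convert f) (tile ρ)))
    where
    r = affine (+ toℕ ρ) (+ 0) (+ 0)
    convert : ∀ f → 6 ∣ᶠ (f ⊖ hub s ⊖ r) → ∃ λ h → eval A f - eval A (hub s) - + toℕ ρ ≡ + 6 * h
    convert f div with eval-∣ᶠ 6 A (f ⊖ hub s ⊖ r) div
    ... | h , eq = h , trans (sym (trans (eval-⊖ A (f ⊖ hub s) r) (cong₂ _-_ (eval-⊖ A f (hub s))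
      (solve 3 (λ ρ k A → ρ :+ con (+ 0) :* k :+ con (+ 0) :* A := ρ) refl (+ toℕ ρ) (+ k) A)))) eq

  tiles-transversal : All Transversal (members tiles)
  tiles-transversal = members-All tile⇒transversal tiles running-tile initial-tile final-tile

  private
    wrap : ∀ f t e q p → q ≡ e + p * + m → f + t + + 6 * q ≡ f + (t + + 6 * e) + p * + v
    wrap f t e q p refl = trans
      (solve 5 (λ f t e p m → f :+ t :+ con (+ 6) :* (e :+ p :* m) := f :+ (t :+ con (+ 6) :* e) :+ p :*
          (m :* con (+ 3) :* con (+ 2))) refl f t e p (+ m))
      (cong (λ v → f + (t + + 6 * e) + p * v) (sym vℤ))

    residue : ∀ x t c f h ρ q → x - t - c ≡ ρ + q * + 6 → f - c - ρ ≡ + 6 * h → x ≡ f + t + + 6 * (q - h)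
    residue x t c f h ρ q eq₁ eq₂ = begin
      x                             ≡⟨ solve 3 (λ x t c → x := x :- t :- c :+ t :+ c) refl x t c ⟩
      x - t - c + t + c             ≡⟨ cong (λ w → w + t + c) eq₁ ⟩
      ρ + q * + 6 + t + c           ≡⟨ solve 5 (λ ρ q t c f → ρ :+ q :* con (+ 6) :+ t :+ c := f :- (f :- c :- ρ) :+
          t :+ q :* con (+ 6)) refl ρ q t c f ⟩
      f - (f - c - ρ) + t + q * + 6 ≡⟨ cong (λ w → f - w + t + q * + 6) eq₂ ⟩
      f - + 6 * h + t + q * + 6     ≡⟨ solve 4 (λ f h t q → f :- con (+ 6) :* h :+ t :+ q :* con (+ 6) := f :+ t :+
          con (+ 6) :* (q :- h)) refl f h t q ⟩
      f + t + + 6 * (q - h)         ∎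
      where open ≡-Reasoning

  -- The class of x - t - hub modulo 6 selects the point f of the star. Then x - t - f is a multiple
  -- of 6, and since 6 m = v its quotient by 6 counts only modulo m; this residue selects the
  -- translate.
  tile-covers : ∀ s → Transversal s → ∀ t x → Any (λ e → x ∈ starVertices (starAt (t + + 6 * + e) s)) (upTo m)
  tile-covers s tr t x = found (find (tr (fromℕ< (n%ℕd<d w 6))))
    where
    w = + toℕ x - t - hub s
    found : (∃ λ f → f ∈ points s × ∃ λ h → f - hub s - + toℕ (fromℕ< (n%ℕd<d w 6)) ≡ + 6 * h) →
            Any (λ e → x ∈ starVertices (starAt (t + + 6 * + e) s)) (upTo m)
    found (f , f∈ , h , eq) = lose (∈-upTo⁺ (n%ℕd<d q m))
      (cover x (t + + 6 * + (q %ℕ m)) s f (q /ℕ m) f∈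
        (trans (residue (+ toℕ x) t (hub s) f h (+ (w %ℕ 6)) (w /ℕ 6) (a≡a%ℕn+[a/ℕn]*n w 6)
                 (trans (cong (λ ρ → f - hub s - + ρ) (sym (Fin.toℕ-fromℕ< (n%ℕd<d w 6)))) eq))
               (wrap f t (+ (q %ℕ m)) q (q /ℕ m) (a≡a%ℕn+[a/ℕn]*n q m))))
      where q = w /ℕ 6 - h

  tileFactor-covers : ∀ s → s ∈ members tiles → ∀ j x → x ∈ concatMap starVertices (tileFactor s j)
  tileFactor-covers s s∈ j x = ∈-concatMap⁺ starVertices
    (Any.map⁺ {f = λ e → starAt (+ 2 * + j + + 6 * + e) s} (tile-covers s (All.lookup tiles-transversal s∈) (+ 2 * + j) x))

  -- Every edge occurs in some factor

  -- Both orders are kept so that an edge can be treated from either end.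
  Covered : Fin v → Fin v → Set
  Covered x y = (x , y) ∈ allEdges factors × (y , x) ∈ allEdges factors

  star-edge : ∀ {F S l} → F ∈ factors → S ∈ F → l ∈ toList (leaves S) → Covered (center S) l
  star-edge {F} F∈ S∈ l∈ =
    ∈-concatMap⁺ edges (lose F∈ (FactorEdge⇒∈ F (lose S∈ (inj₁ (refl , ∈-toList⁻ l∈))))) ,
    ∈-concatMap⁺ edges (lose F∈ (FactorEdge⇒∈ F (lose S∈ (inj₂ (refl , ∈-toList⁻ l∈)))))

  -- What base stars and tiled stars have in common, and all that `arc-covered` asks of a star
  -- besides its arc.
  Translates : Shape ℤ → Set
  Translates s = ∀ T → ∃ λ F → F ∈ factors × starAt (+ 2 * T) s ∈ F

  base-translates : ∀ {s} → s ∈ members base → Translates s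
  base-translates {s} s∈ T = baseFactor j , ∈-++⁺ˡ (∈-map⁺ baseFactor (∈-upTo⁺ (n%ℕd<d T (m ℕ.* 3)))) ,
    subst (_∈ baseFactor j) (sym (starAt-period (T /ℕ (m ℕ.* 3)) s (begin
      + 2 * T                                        ≡⟨ cong (_*_ (+ 2)) (a≡a%ℕn+[a/ℕn]*n T (m ℕ.* 3)) ⟩
      + 2 * (+ j + q * + (m ℕ.* 3))                  ≡⟨ solve 3 (λ j q h → con (+ 2) :* (j :+ q :* h) := con (+ 2)
          :* j :+ q :* (h :* con (+ 2))) refl (+ j) q (+ (m ℕ.* 3)) ⟩
      + 2 * + j + q * (+ (m ℕ.* 3) * + 2)            ≡⟨ cong (λ v → + 2 * + j + q * v) (ℤ.pos-* (m ℕ.* 3) 2) ⟨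
      + 2 * + j + q * + v                            ∎))) (∈-map⁺ (starAt (+ 2 * + j)) s∈)
    where
    open ≡-Reasoning
    j = T %ℕ (m ℕ.* 3)
    q = T /ℕ (m ℕ.* 3)

  -- With T = j + 3 q and q = e + p m one has 2 T = 2 j + 6 e + p v; here j selects the factor and e
  -- the star in it.
  tile-translates : ∀ {s} → s ∈ members tiles → Translates s
  tile-translates {s} s∈ T = tileFactor s j ,
    ∈-++⁺ʳ (map baseFactor (upTo (m ℕ.* 3))) (∈-concatMap⁺ (λ s → map (tileFactor s) (upTo 3))
        (lose s∈ (∈-map⁺ (tileFactor s) (∈-upTo⁺ (n%ℕd<d T 3))))) ,
    subst (_∈ tileFactor s j) (sym (starAt-period p s (begin
      + 2 * T                                        ≡⟨ cong (_*_ (+ 2)) (a≡a%ℕn+[a/ℕn]*n T 3) ⟩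
      + 2 * (+ j + q * + 3)                          ≡⟨ solve 2 (λ j q → con (+ 2) :* (j :+ q :* con (+ 3)) := con
          (+ 0) :+ con (+ 2) :* j :+ con (+ 6) :* q) refl (+ j) q ⟩
      + 0 + + 2 * + j + + 6 * q                      ≡⟨ wrap (+ 0) (+ 2 * + j) (+ e) q p (a≡a%ℕn+[a/ℕn]*n q m) ⟩
      + 0 + (+ 2 * + j + + 6 * + e) + p * + v        ≡⟨ cong (_+ p * + v) (ℤ.+-identityˡ (+ 2 * + j + + 6 * + e)) ⟩
      + 2 * + j + + 6 * + e + p * + v                ∎))) (∈-map⁺ (λ e → starAt (+ 2 * + j + + 6 * + e) s)
          (∈-upTo⁺ (n%ℕd<d q m)))
    where
    open ≡-Reasoning
    j = T %ℕ 3
    q = T /ℕ 3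
    e = q %ℕ m
    p = q /ℕ m

  ArcAt : ℤ → ℤ → ℤ × ℤ → Set
  ArcAt a b (p , d) = ∃₂ λ h q → a ≡ p + + 2 * h × b ≡ a + d + q * + v

  StarArc : Shape ℤ → ℤ × ℤ → Set
  StarArc s i = Any (λ l → ArcAt (hub s) l i ⊎ ArcAt l (hub s) i) (toList (rim s))

  private
    arc-sound : ∀ A a b p d → Arc a b (p , d) → ArcAt (eval A a) (eval A b) (eval A p , eval A d)
    arc-sound A a b p d (diff , even) with eval-∣ᶠ 2 A (a ⊖ p) even
    ... | h , eq = h , proj₁ (target diff) , (begin
        eval A a                           ≡⟨ solve 2 (λ a p → a := p :+ (a :- p)) refl (eval A a) (eval A p) ⟩
        eval A p + (eval A a - eval A p)   ≡⟨ cong (_+_ (eval A p)) (trans (sym (eval-⊖ A a p)) eq) ⟩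
        eval A p + + 2 * h                 ∎) , proj₂ (target diff)
      where
      open ≡-Reasoning
      step : ∀ a b d w q → b - a ≡ d + q * w → b ≡ a + d + q * w
      step a b d w q eq = trans (solve 2 (λ a b → b := a :+ (b :- a)) refl a b)
        (trans (cong (_+_ a) eq) (sym (ℤ.+-assoc a d (q * w))))
      target : b ⊖ a ≡ d ⊎ b ⊖ a ≡ d ⊖ order → ∃ λ q → eval A b ≡ eval A a + eval A d + q * + v
      target (inj₁ e) = + 0 , step (eval A a) (eval A b) (eval A d) (+ v) (+ 0)
        (trans (sym (eval-⊖ A b a)) (trans (cong (eval A) e) (sym (ℤ.+-identityʳ (eval A d)))))
      target (inj₂ e) = - + 1 , step (eval A a) (eval A b) (eval A d) (+ v) (- + 1)
        (trans (sym (eval-⊖ A b a)) (trans (cong (eval A) e) (trans (eval-⊖ A d order)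
          (cong (_+_ (eval A d)) (trans (cong -_ (eval-order A)) (sym (ℤ.-1*i≡-i (+ v))))))))

    match-sound : ∀ A s p d → ArcMatch s (p , d) → StarArc (at A s) (eval A p , eval A d)
    match-sound A (shape c ls) p d match = subst (Any _) (sym (Vec.toList-map (eval A) ls))
      (Any.map⁺ (Any.map (λ {l} → Sum.map (arc-sound A c l p d) (arc-sound A l c p d)) match))

    module B = Search.Soundness ArcMatch arcMatch? base k StarArc match-sound
    module T = Search.Soundness ArcMatch arcMatch? tiles k StarArc match-sound

  private
    shifted-ends : ∀ x p d t h q a b → x ≡ p + + 2 * t → a ≡ p + + 2 * h → b ≡ a + d + q * + v →
                   pt v (a + + 2 * (t - h)) ≡ pt v x × pt v (b + + 2 * (t - h)) ≡ pt v (x + d)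
    shifted-ends x p d t h q a b refl refl refl =
      cong (pt v) (solve 3 (λ p t h → p :+ con (+ 2) :* h :+ con (+ 2) :* (t :- h) := p :+ con (+ 2) :* t) refl p t h) ,
      pt-period v {b + + 2 * (t - h)} {x + d} q
        (solve 5 (λ p t h d w → p :+ con (+ 2) :* h :+ d :+ w :+ con (+ 2) :* (t :- h) := p :+ con (+ 2) :* t :+ d
            :+ w) refl p t h d (q * + v))

    rim∈ : ∀ t s {l} → l ∈ toList (rim s) → pt v (l + t) ∈ toList (leaves (starAt t s))
    rim∈ t (shape c ls) {l} l∈ = subst (pt v (l + t) ∈_) (sym (Vec.toList-map (λ l → pt v (l + t)) ls))
        (∈-map⁺ (λ l → pt v (l + t)) l∈)

  -- The arc starts at some a ≡ p ≡ x modulo 2, so the even translation by x - a carries it to the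
  -- arc from x to x + d. The two cases are arcs leaving the hub and arcs entering it.
  arc-covered : ∀ s → Translates s → ∀ x p d t → x ≡ p + + 2 * t → StarArc s (p , d) → Covered (pt v x) (pt v (x + d))
  arc-covered s tr x p d t x≡ arc with find arc
  ... | l , l∈ , inj₁ (h , q , a≡ , b≡) =
    let F , F∈ , s∈ = tr (t - h)
        ex , ey = shifted-ends x p d t h q (hub s) l x≡ a≡ b≡
    in subst₂ Covered ex ey (star-edge F∈ s∈ (rim∈ (+ 2 * (t - h)) s l∈))
  ... | l , l∈ , inj₂ (h , q , a≡ , b≡) =
    let F , F∈ , s∈ = tr (t - h)
        ex , ey = shifted-ends x p d t h q l (hub s) x≡ a≡ b≡
    in subst₂ Covered ex ey (swap (star-edge F∈ s∈ (rim∈ (+ 2 * (t - h)) s l∈)))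

  private
    pair-covered : ∀ x A b ρ → B.Hit A (pair b ρ) ⊎ T.Hit A (pair b ρ) →
                   ∀ t → x - A ≡ + b + t * + 2 → ∀ d → d ≡ + 1 + + ρ + A * + 30 → Covered (pt v x) (pt v (x + d))
    pair-covered x A b ρ hit t x≡ d d≡ =
      subst (λ d → Covered (pt v x) (pt v (x + d))) (sym (trans d≡ (solve 3 (λ ρ A k → con (+ 1) :+ ρ :+ A :* con (+ 30)
          := con (+ 1) :+ ρ :+ con (+ 0) :* k :+ con (+ 30) :* A) refl (+ ρ) A (+ k))))
        ([ (λ (s , s∈ , arc) → arc-covered s (base-translates s∈) x p e t parity arc)
         , (λ (s , s∈ , arc) → arc-covered s (tile-translates s∈) x p e t parity arc) ]′ hit)
      where
      open ≡-Reasoning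
      p e : ℤ
      p = eval A (proj₁ (pair b ρ))
      e = eval A (proj₂ (pair b ρ))
      parity : x ≡ p + + 2 * t
      parity = begin
        x                    ≡⟨ solve 2 (λ x A → x := x :- A :+ A) refl x A ⟩
        x - A + A            ≡⟨ cong (_+ A) x≡ ⟩
        + b + t * + 2 + A    ≡⟨ solve 4 (λ b t A k → b :+ t :* con (+ 2) :+ A := b :+ con (+ 0) :* k :+ con (+ 1) :*
            A :+ con (+ 2) :* t) refl (+ b) t A (+ k) ⟩
        + b + + 0 * + k + + 1 * A + + 2 * t ∎

    parity-split : ∀ z → ∃₂ λ (b : Fin 2) t → z ≡ + toℕ b + t * + 2
    parity-split z = fromℕ< (n%ℕd<d z 2) , z /ℕ 2 ,
      trans (a≡a%ℕn+[a/ℕn]*n z 2) (cong (λ r → + r + (z /ℕ 2) * + 2) (sym (Fin.toℕ-fromℕ< (n%ℕd<d z 2))))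

    running-pair : ∀ x A → A ℕ.< k → (ρ : Fin 30) → (∃₂ λ (b : Fin 2) t → x - + A ≡ + toℕ b + t * + 2) →
                   ∀ d → d ≡ + 1 + + toℕ ρ + + A * + 30 → Covered (pt v x) (pt v (x + d))
    running-pair x A A<k ρ (b , t , eq) = pair-covered x (+ A) (toℕ b) (toℕ ρ)
      (Sum.map (B.found⇒hit (pair (toℕ b) (toℕ ρ)) A A<k) (T.found⇒hit (pair (toℕ b) (toℕ ρ)) A A<k) (pairs b ρ)) t eq

    last-pair : ∀ x → (ρ : Fin (m₀ ℕ.* 3 ℕ.∸ 1)) → (∃₂ λ (b : Fin 2) t → x - + k ≡ + toℕ b + t * + 2) →
                ∀ d → d ≡ + 1 + + toℕ ρ + + k * + 30 → Covered (pt v x) (pt v (x + d))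
    last-pair x ρ (b , t , eq) = pair-covered x (+ k) (toℕ b) (toℕ ρ)
      (Sum.map (B.foundLast⇒hit (pair (toℕ b) (toℕ ρ))) (T.foundLast⇒hit (pair (toℕ b) (toℕ ρ))) (last-pairs b ρ)) t eq

    half≡ : m ℕ.* 3 ≡ suc (k ℕ.* 30 ℕ.+ (m₀ ℕ.* 3 ℕ.∸ 1))
    half≡ = begin
      m ℕ.* 3                                      ≡⟨ S.solve 2 (λ m k → (m S.:+ k S.:* S.con 10) S.:* S.con 3 S.:=
          k S.:* S.con 30 S.:+ m S.:* S.con 3) refl m₀ k ⟩
      k ℕ.* 30 ℕ.+ m₀ ℕ.* 3                        ≡⟨ cong (k ℕ.* 30 ℕ.+_)
          (ℕ.m+[n∸m]≡n {1} {m₀ ℕ.* 3} (ℕ.>-nonZero⁻¹ (m₀ ℕ.* 3) {{ℕ.m*n≢0 m₀ 3}})) ⟨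
      k ℕ.* 30 ℕ.+ suc (m₀ ℕ.* 3 ℕ.∸ 1)            ≡⟨ ℕ.+-suc (k ℕ.* 30) (m₀ ℕ.* 3 ℕ.∸ 1) ⟩
      suc (k ℕ.* 30 ℕ.+ (m₀ ℕ.* 3 ℕ.∸ 1))          ∎
      where
      open ≡-Reasoning
      module S = ℕ-Solver

  -- Distances start at 1, hence the `suc`. The first 30 k of them fall into blocks with A < k; the
  -- remaining 3 `m₀` - 1 below v / 2 belong to A = k.
  short-covered : ∀ x d → suc d ℕ.< m ℕ.* 3 → Covered (pt v x) (pt v (x + + suc d))
  short-covered x d d< =
    [ (λ d<′ → first (block-up 30 {k} d<′)) , last ]′ (split-+ (k ℕ.* 30) (ℕ.s≤s⁻¹ (subst (suc d ℕ.<_) half≡ d<)))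
    where
    first : (∃ λ A → ∃ λ (ρ : Fin 30) → A ℕ.< k × + d ≡ + toℕ ρ + + A * + 30) → Covered (pt v x) (pt v (x + + suc d))
    first (A , ρ , A<k , eq) = running-pair x A A<k ρ (parity-split (x - + A)) (+ suc d)
      (trans (cong (_+_ (+ 1)) eq) (sym (ℤ.+-assoc (+ 1) (+ toℕ ρ) (+ A * + 30))))
    last : (∃ λ r → r ℕ.< m₀ ℕ.* 3 ℕ.∸ 1 × d ≡ k ℕ.* 30 ℕ.+ r) → Covered (pt v x) (pt v (x + + suc d))
    last (r , r< , eq) = last-pair x (fromℕ< r<) (parity-split (x - + k)) (+ suc d)
      (trans (cong (λ d → + 1 + + d) eq) (trans (cong₂ (λ a r → + 1 + (a + + r)) (ℤ.pos-* k 30) (sym (Fin.toℕ-fromℕ< r<)))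
        (solve 2 (λ ρ a → con (+ 1) :+ (a :+ ρ) := con (+ 1) :+ ρ :+ a) refl (+ toℕ (fromℕ< r<)) (+ k * + 30))))

  matching : PerfectMatching v
  matching = antipodal (m ℕ.* 3)

  -- Let d be y - x reduced modulo v. The values 0 and v / 2 are excluded, being equality and the
  -- matching, and a d above v / 2 becomes the short distance v - d from y to x.
  edge-covered : ∀ x y → EdgeKmI matching x y → Covered x y
  edge-covered x y (x≢y , y≢x′) = by-distance (w %ℕ v) (n%ℕd<d w v) (a≡a%ℕn+[a/ℕn]*n w v)
    where
    X Y w q : ℤ
    X = + toℕ x
    Y = + toℕ y
    w = Y - X
    q = w /ℕ v
    open ≡-Reasoning

    end : ∀ d → w ≡ + d + q * + v → pt v (X + + d) ≡ y
    end d eq = trans (sym (pt-period v {Y} {X + + d} q (begin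
      Y                       ≡⟨ solve 2 (λ x y → y := x :+ (y :- x)) refl X Y ⟩
      X + w                   ≡⟨ cong (_+_ X) eq ⟩
      X + (+ d + q * + v)     ≡⟨ ℤ.+-assoc X (+ d) (q * + v) ⟨
      X + + d + q * + v       ∎))) (pt-toℕ v y)

    back : ∀ d d′ → w ≡ + d + q * + v → + d + + d′ ≡ + v → pt v (Y + + d′) ≡ x
    back d d′ eq total = trans (pt-period v {Y + + d′} {X} (+ 1 + q) (begin
      Y + + d′                          ≡⟨ solve 3 (λ x y d → y :+ d := x :+ (y :- x) :+ d) refl X Y (+ d′) ⟩
      X + w + + d′                      ≡⟨ cong (λ w → X + w + + d′) eq ⟩
      X + (+ d + q * + v) + + d′        ≡⟨ solve 4 (λ x d e w → x :+ (d :+ w) :+ e := x :+ (d :+ e) :+ w) refl X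
          (+ d) (+ d′) (q * + v) ⟩
      X + (+ d + + d′) + q * + v        ≡⟨ cong (λ e → X + e + q * + v) total ⟩
      X + + v + q * + v                 ≡⟨ solve 3 (λ x q v → x :+ v :+ q :* v := x :+ (con (+ 1) :+ q) :* v) refl X q (+ v) ⟩
      X + (+ 1 + q) * + v               ∎)) (pt-toℕ v x)

    by-distance : ∀ d → d ℕ.< v → w ≡ + d + q * + v → Covered x y
    by-distance zero _ eq = contradiction (trans (sym (pt-toℕ v x)) (trans (cong (pt v) (sym (ℤ.+-identityʳ X)))
        (end 0 eq))) x≢y
    by-distance (suc d) d<v eq with ℕ.<-cmp (suc d) (m ℕ.* 3)
    ... | tri< d<h _ _ = subst₂ Covered (pt-toℕ v x) (end (suc d) eq) (short-covered X d d<h)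
    ... | tri≈ _ d≡h _ = contradiction (sym (trans (cong (λ d → pt v (X + + d)) (sym d≡h)) (end (suc d) eq))) y≢x′
    ... | tri> _ _ d>h = swap (subst₂ Covered (pt-toℕ v y)
        (trans (cong (λ d → pt v (Y + + d)) e≡) (back (suc d) (v ℕ.∸ suc d) eq (cong +_ (ℕ.m+[n∸m]≡n (ℕ.<⇒≤ d<v)))))
        (short-covered Y (ℕ.pred (v ℕ.∸ suc d)) (subst (ℕ._< m ℕ.* 3) (sym e≡) short)))
      where
      e≡ : suc (ℕ.pred (v ℕ.∸ suc d)) ≡ v ℕ.∸ suc d
      e≡ = ℕ.suc-pred (v ℕ.∸ suc d) {{ℕ.>-nonZero (ℕ.m<n⇒0<n∸m d<v)}}
      v≡ : v ≡ m ℕ.* 3 ℕ.+ m ℕ.* 3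
      v≡ = trans (ℕ.*-comm (m ℕ.* 3) 2) (cong (m ℕ.* 3 ℕ.+_) (ℕ.+-identityʳ (m ℕ.* 3)))
      short : v ℕ.∸ suc d ℕ.< m ℕ.* 3
      short = subst (v ℕ.∸ suc d ℕ.<_) (trans (cong (ℕ._∸ m ℕ.* 3) v≡) (ℕ.m+n∸n≡m (m ℕ.* 3) (m ℕ.* 3)))
          (ℕ.∸-monoʳ-< d>h (ℕ.<⇒≤ d<v))

  decomposition : StarFactorDecomposition matching
  decomposition = decomposition-from-cover matching m (ℕ.*-assoc m 3 2) factors
    (factors-all length-baseFactor (λ s _ → length-tileFactor s))
    (factors-all baseFactor-covers tileFactor-covers)
    (λ x y e → proj₁ (edge-covered x y e))
    length-factors

-- The designs for v = 60 k + 42 and v = 60 k + 72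

-- The coefficients - 5 and 25 of A differ by 30 and are both odd. So when A grows by one, distances
-- grow by 30 and both ends change parity, in step with `pair`. In `farStar` hub and leaves exchange
-- sides.
rightStar farStar : ℕ → Vec ℕ 5 → Shape Affine
rightStar a bs = shape (affine (- + a) (+ 0) (- + 5)) (Vec.map (λ b → affine (+ b) (+ 0) (+ 25)) bs)
farStar a bs = shape (affine (+ a) (+ 0) (+ 25)) (Vec.map (λ b → affine (- + b) (+ 0) (- + 5)) bs)

-- The mirror image of `rightStar` under the reflection of x to - near - 10 k - x.
leftStar : ℕ → ℕ → Vec ℕ 5 → Shape Affine
leftStar near a bs = shape (affine (+ a - + near) (- + 10) (+ 5)) (Vec.map
    (λ b → affine (- + (near ℕ.+ b)) (- + 10) (- + 25)) bs)

fixedStar : ℤ → Vec ℤ 5 → Shape Affine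
fixedStar c ls = shape (affine c (+ 0) (+ 0)) (Vec.map (λ l → affine l (+ 0) (+ 0)) ls)

-- An entry d stands for the leaves at distance d + 30 A (d > 0) or d − 30 A (d < 0) from the hub.
tileStar : ℕ → Vec ℤ 5 → Shape Affine
tileStar c ds = shape c₀ (Vec.map (λ d → c₀ ⊕ affine d (+ 0) (ℤ.sign d ℤ.◃ 30)) ds)
  where c₀ = affine (+ c) (+ 0) (+ 1)

design₁ : Design
design₁ = record
  { m₀ = 7
  ; near = 12
  ; far = 29
  ; base = record
    { running =
      ( rightStar 0 (8 ∷ 10 ∷ 12 ∷ 18 ∷ 24 ∷ [])
      ∷ rightStar 1 (4 ∷ 11 ∷ 13 ∷ 14 ∷ 19 ∷ [])
      ∷ rightStar 7 (27 ∷ 28 ∷ 30 ∷ 16 ∷ 25 ∷ [])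
      ∷ rightStar 8 (6 ∷ 15 ∷ 17 ∷ 22 ∷ 23 ∷ [])
      ∷ rightStar 9 (1 ∷ 7 ∷ 9 ∷ 20 ∷ 21 ∷ [])
      ∷ leftStar 12 0 (7 ∷ 9 ∷ 11 ∷ 13 ∷ 19 ∷ [])
      ∷ leftStar 12 1 (2 ∷ 3 ∷ 5 ∷ 14 ∷ 16 ∷ [])
      ∷ leftStar 12 2 (1 ∷ 4 ∷ 15 ∷ 18 ∷ 20 ∷ [])
      ∷ leftStar 12 3 (6 ∷ 8 ∷ 10 ∷ 21 ∷ 25 ∷ [])
      ∷ leftStar 12 4 (12 ∷ 17 ∷ 22 ∷ 23 ∷ 24 ∷ [])
      ∷ [])
    -- The hubs 7, 8, 9 and the leaves 27, 28, 30 above run one block late. This star takes the six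
    -- places - 2, - 3, - 4, 2, 3, 5 that they leave open at A = 0.
    ; initial = fixedStar (-[1+ 1 ]) (-[1+ 2 ] ∷ -[1+ 3 ] ∷ + 3 ∷ + 5 ∷ + 2 ∷ []) ∷ []
    -- At A = k the places 2, 3, 4 on the near side and 2, 3, 5 on the far side are omitted: the
    -- late running members fill them, or the initial star if k = 0.
    ; final =
      ( rightStar 6 (12 ∷ 14 ∷ 17 ∷ 19 ∷ 27 ∷ [])
      ∷ rightStar 8 (4 ∷ 8 ∷ 9 ∷ 11 ∷ 21 ∷ [])
      ∷ rightStar 10 (18 ∷ 22 ∷ 24 ∷ 26 ∷ 29 ∷ [])
      ∷ rightStar 5 (6 ∷ 7 ∷ 10 ∷ 15 ∷ 23 ∷ [])
      ∷ rightStar 11 (13 ∷ 16 ∷ 20 ∷ 25 ∷ 28 ∷ [])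
      ∷ farStar 1 (0 ∷ 1 ∷ 7 ∷ 9 ∷ 12 ∷ [])
      ∷ [])
    }
  ; tiles = record
    { running =
      ( tileStar 1 (+ 8 ∷ -[1+ 1 ] ∷ -[1+ 0 ] ∷ -[1+ 26 ] ∷ + 25 ∷ [])
      ∷ tileStar 1 (+ 26 ∷ + 22 ∷ -[1+ 18 ] ∷ -[1+ 20 ] ∷ -[1+ 28 ] ∷ [])
      ∷ [])
    ; initial = []
    ; final =
      ( tileStar 1 (+ 4 ∷ -[1+ 15 ] ∷ + 5 ∷ -[1+ 8 ] ∷ + 7 ∷ [])
      ∷ [])
    }
  }

design₂ : Design
design₂ = record
  { m₀ = 12
  ; near = 53
  ; far = 18
  ; base = record
    { running =
      ( rightStar 0 (10 ∷ 14 ∷ 16 ∷ 17 ∷ 24 ∷ [])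
      ∷ rightStar 1 (1 ∷ 3 ∷ 6 ∷ 7 ∷ 9 ∷ [])
      ∷ rightStar 7 (27 ∷ 29 ∷ 30 ∷ 12 ∷ 25 ∷ [])
      ∷ rightStar 8 (11 ∷ 19 ∷ 20 ∷ 22 ∷ 23 ∷ [])
      ∷ rightStar 9 (8 ∷ 13 ∷ 15 ∷ 18 ∷ 21 ∷ [])
      ∷ leftStar 53 0 (1 ∷ 6 ∷ 14 ∷ 16 ∷ 18 ∷ [])
      ∷ leftStar 53 1 (2 ∷ 4 ∷ 8 ∷ 11 ∷ 21 ∷ [])
      ∷ leftStar 53 2 (3 ∷ 10 ∷ 13 ∷ 19 ∷ 23 ∷ [])
      ∷ leftStar 53 3 (12 ∷ 15 ∷ 17 ∷ 20 ∷ 22 ∷ [])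
      ∷ leftStar 53 4 (5 ∷ 7 ∷ 9 ∷ 24 ∷ 25 ∷ [])
      ∷ [])
    -- As in `design₁`, now for the late hubs 7, 8, 9 and leaves 27, 29, 30.
    ; initial = fixedStar (-[1+ 1 ]) (+ 5 ∷ + 2 ∷ + 4 ∷ -[1+ 2 ] ∷ -[1+ 3 ] ∷ []) ∷ []
    ; final =
      ( rightStar 41 (3 ∷ 7 ∷ 12 ∷ 13 ∷ 14 ∷ [])
      ∷ farStar 15 (24 ∷ 28 ∷ 34 ∷ 40 ∷ 50 ∷ [])
      ∷ farStar 6 (6 ∷ 7 ∷ 15 ∷ 22 ∷ 35 ∷ [])
      ∷ farStar 10 (10 ∷ 17 ∷ 25 ∷ 32 ∷ 46 ∷ [])
      ∷ farStar 18 (31 ∷ 33 ∷ 39 ∷ 44 ∷ 49 ∷ [])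
      ∷ farStar 17 (36 ∷ 43 ∷ 47 ∷ 51 ∷ 52 ∷ [])
      ∷ farStar 8 (1 ∷ 16 ∷ 23 ∷ 26 ∷ 29 ∷ [])
      ∷ farStar 1 (0 ∷ 5 ∷ 8 ∷ 9 ∷ 12 ∷ [])
      ∷ farStar 11 (14 ∷ 19 ∷ 21 ∷ 27 ∷ 45 ∷ [])
      ∷ farStar 16 (30 ∷ 38 ∷ 42 ∷ 48 ∷ 53 ∷ [])
      ∷ farStar 9 (11 ∷ 13 ∷ 18 ∷ 20 ∷ 37 ∷ [])
      ∷ [])
    }
  ; tiles = record
    { running =
      ( tileStar 0 (+ 26 ∷ -[1+ 7 ] ∷ -[1+ 10 ] ∷ -[1+ 20 ] ∷ + 23 ∷ [])
      ∷ tileStar 1 (+ 26 ∷ -[1+ 19 ] ∷ + 29 ∷ -[1+ 2 ] ∷ + 13 ∷ [])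
      ∷ [])
    ; initial = []
    ; final =
      ( tileStar 0 (+ 22 ∷ + 32 ∷ -[1+ 4 ] ∷ -[1+ 14 ] ∷ -[1+ 24 ] ∷ [])
      ∷ tileStar 1 (+ 2 ∷ -[1+ 13 ] ∷ + 11 ∷ -[1+ 32 ] ∷ -[1+ 10 ] ∷ [])
      ∷ [])
    }
  }

certificate₁ : Certificates.Certificate design₁
certificate₁ = from-yes (Certificates.certificate? design₁)

certificate₂ : Certificates.Certificate design₂
certificate₂ = from-yes (Certificates.certificate? design₂)

-- The case v = 12

-- An edge outside the antipodal matching is {x , x + d} for exactly one x and one d from 1 to 5, so
-- it lies in the fan at x only. The fans at j and j + 6 together fill ℤ/12.
fan : ℕ → Star5 12
fan x = star (pt 12 (+ x)) (Vec.map (λ i → pt 12 (+ (x ℕ.+ i))) (1 ∷ 2 ∷ 3 ∷ 4 ∷ 5 ∷ []))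

dodecagon : StarFactorDecomposition (antipodal 6)
dodecagon = decomposition-from-cover (antipodal 6) 2 refl factors
  (from-yes (All.all? (λ F → length F ℕ.≟ 2) factors))
  (from-yes (All.all? (λ F → Fin.all? λ x → x ∈? concatMap starVertices F) factors))
  (from-yes (Fin.all? λ x → Fin.all? λ y → EdgeKmI? (antipodal 6) (x , y) →-dec (x , y) ∈²? allEdges factors))
  refl
  where
  open Membership (Fin._≟_ {12}) using (_∈?_)
  open Membership (≡-dec (Fin._≟_ {12}) (Fin._≟_ {12})) using () renaming (_∈?_ to _∈²?_)
  factors : List (List (Star5 12))
  factors = map (λ j → fan j ∷ fan (j ℕ.+ 6) ∷ []) (upTo 6)

-- All residues 12 modulo 30, and the equivalence

Decomposable : ℕ → Set
Decomposable v = Σ (PerfectMatching v) StarFactorDecomposition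

decomposable : ∀ n → Decomposable (12 ℕ.+ n ℕ.* 30)
decomposable zero = antipodal 6 , dodecagon
-- Writing n as r + 2 k, the order is 60 k + 42 for r = 0 and 60 k + 72 for r = 1.
decomposable (suc n) = subst (λ n → Decomposable (12 ℕ.+ suc n ℕ.* 30)) (sym (ℕ.m≡m%n+[m/n]*n n 2))
    (by-parity (n ℕ.% 2) (ℕ.m%n<n n 2) (n ℕ./ 2))
  where
  open ℕ-Solver
  by-parity : ∀ r → r ℕ.< 2 → ∀ k → Decomposable (12 ℕ.+ suc (r ℕ.+ k ℕ.* 2) ℕ.* 30)
  by-parity 0 _ k = subst Decomposable
    (solve 1 (λ k → (con 7 :+ k :* con 10) :* con 3 :* con 2 := con 12 :+ (con 1 :+ k :* con 2) :* con 30) refl k)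
    (_ , Construction.decomposition design₁ certificate₁ k)
  by-parity 1 _ k = subst Decomposable
    (solve 1 (λ k → (con 12 :+ k :* con 10) :* con 3 :* con 2 := con 12 :+ (con 2 :+ k :* con 2) :* con 30) refl k)
    (_ , Construction.decomposition design₂ certificate₂ k)
  by-parity (suc (suc _)) (s≤s (s≤s ())) _

mainTheorem1 : (v : ℕ) → 3 ≤ v →
    (Σ (PerfectMatching v) (λ I → StarFactorDecomposition I)) ⇔ (v % 30 ≡ 12)
mainTheorem1 v 3≤v = mk⇔ (λ (I , D) → necessity 3≤v D) λ v%30≡12 →
  subst Decomposable (sym (trans (ℕ.m≡m%n+[m/n]*n v 30) (cong (ℕ._+ (v ℕ./ 30) ℕ.* 30) v%30≡12))) (decomposable (v ℕ./ 30))
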